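{- Let $F=\breve F(\alpha_1,\dots,\alpha_t)$ be a fence. Every statistic in \[ \operatorname{Span}_{\mathbb R}\Big(\bigcup_{i=1}^t\bigcup_{j=1}^{\beta_i}\{\alpha_i\hat\chi_{(i,j)}-j\hat\chi_p-(\alpha_i-j)\hat\chi_v : p\text{ the peak of }S_i,\ v\text{ the valley of }S_i\}\Big) \] is homomesic under promotion $\mathrm{Pro}=\tau_{x_n}\circ\cdots\circ\tau_{x_1}$ acting on $\mathcal J(F)$.
   Context: Fences: let $\alpha=(\alpha_1,\dots,\alpha_t)$ be positive integers with $t\ge2$ and $\alpha_1,\alpha_t\ge2$. Put $a_0=0$, $a_i=\alpha_1+\dots+\alpha_i$, $n=a_t-1$. The fence $\breve F(\alpha)$ is the poset on $\{x_1,\dots,x_n\}$ whose cover relations are: for $1\le j\le n-1$ with $a_{i-1}\le j<a_i$, $x_j\lessdot x_{j+1}$ if $i$ is odd and $x_j\gtrdot x_{j+1}$ if $i$ is even. Segments: $S_1=\{x_j:1\le j\le a_1\}$, $S_i=\{x_j:a_{i-1}\le j\le a_i\}$ for $2\le i\le t-1$, $S_t=\{x_j:a_{t-1}\le j\le n\}$. Shared elements $x_{a_i}$ ($i\in[t-1]$) are peaks (cover two elements) for $i$ odd and valleys (covered by two elements) for $i$ even; the peak (valley) of $S_i$ is the shared element of $S_i$ that is a peak (valley), and the corresponding $\hat\chi$ is identically zero if none exists. $\breve S_i$ is the set of non-shared elements of $S_i$, $\beta_i=\alpha_i-1$, $s_{(i,j)}$ the $j$-th smallest element of $\breve S_i$,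 $\hat\chi_{(i,j)}=\hat\chi_{s_{(i,j)}}$, where $\hat\chi_q(I)=1$ if $q\in I$ and $0$ otherwise for order ideals $I\in\mathcal J(F)$. The toggle $\tau_q:\mathcal J(F)\to\mathcal J(F)$ adds $q$ to $I$ if $q\in\min(F\setminus I)$, removes $q$ if $q\in\max(I)$, and fixes $I$ otherwise; composition is applied right to left. A statistic is homomesic under a bijection if its average over every orbit is the same constant. -}

module Defs where

open import Level using (0ℓ)
open import Data.Nat as ℕ using (ℕ; zero; suc; _∸_; z≤n; s≤s)
import Data.Nat.Properties as ℕ
open import Data.Nat.ListAction using (sum)
open import Data.Integer using (+_)
open import Data.Rational as ℚ using (ℚ; 0ℚ; 1ℚ; ½; Positive)
import Data.Rational.Properties as ℚ
open import Algebra.Bundles using (CommutativeMonoid)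
open import Algebra.Properties.CommutativeSemigroup (CommutativeMonoid.commutativeSemigroup ℚ.+-0-commutativeMonoid) using (interchange)
open import Data.Parity.Base using (Parity; 0ℙ; 1ℙ)
import Data.Parity.Properties as ℙ
open import Data.Fin as Fin using (Fin; toℕ; fromℕ<)
import Data.Fin.Properties as Fin
open import Data.Fin.Subset using (Subset; _∈_; _∉_; ∁; _∪_; ⁅_⁆; _-_; inside; outside)
open import Data.Fin.Subset.Properties using (_∈?_; x∈p∪q⁻; x∈p∪q⁺; x∈⁅x⁆; x∈⁅y⁆⇒x≡y; p─q⊆p; x∈p∧x≢y⇒x∈p-y; x∉p⇒x∈∁p)
open import Data.List as List using (List; []; _∷_; foldl; foldr; filter; allFin)
import Data.List.Membership.Propositional as List
open import Data.List.NonEmpty as List⁺ using (List⁺; _∷_)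
open import Data.List.Relation.Unary.All using (All)
open import Data.List.Relation.Unary.Unique.Propositional using (Unique)
open import Data.Vec as Vec using (Vec; []; _∷_; here; there; lookup)
open import Data.Product using (∃; ∃₂; _×_; _,_; proj₁; proj₂)
open import Data.Sum using (_⊎_; inj₁; inj₂)
open import Function using (id; _∘_; _⇔_)
import Function.Endo.Propositional as Endo
open import Relation.Binary using (Rel; Decidable; IsDecPartialOrder; tri<; tri≈; tri>)
open import Relation.Binary.Construct.Closure.ReflexiveTransitive as Star using (Star; _◅_; _◅◅_; reverse)
open import Relation.Binary.PropositionalEquality
open import Relation.Nullary using (¬_; Dec; yes; no; contradiction)
open import Relation.Nullary.Decidable using (_×-dec_; _⊎-dec_; _→-dec_; ¬?; map′)
open import Relation.Unary using (Pred)

record ℝ : Set where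
  constructor mkℝ
  field
    seq    : ℕ → ℚ
    cauchy : ∀ ε → .{{Positive ε}} →
             ∃ λ N → ∀ {m n} → N ℕ.≤ m → N ℕ.≤ n →
             ℚ.∣ seq m ℚ.- seq n ∣ ℚ.< ε

open ℝ public

infix 4 _≃_

_≃_ : Rel ℝ 0ℓ
x ≃ y = ∀ ε → .{{Positive ε}} →
        ∃ λ N → ∀ {n} → N ℕ.≤ n → ℚ.∣ seq x n ℚ.- seq y n ∣ ℚ.< ε

fromℚ : ℚ → ℝ
fromℚ q = mkℝ (λ _ → q) λ ε {{ε>0}} → 0 , λ _ _ →
  subst (λ d → ℚ.∣ d ∣ ℚ.< ε) (sym (ℚ.+-inverseʳ q)) (ℚ.positive⁻¹ ε {{ε>0}})

fromℕ : ℕ → ℝ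
fromℕ n = fromℚ (+ n ℚ./ 1)

0ℝ 1ℝ : ℝ
0ℝ = fromℕ 0
1ℝ = fromℕ 1

½-pos : ∀ ε → .{{Positive ε}} → Positive (½ ℚ.* ε)
½-pos ε = ℚ.pos*pos⇒pos ½ ε

½+½ : ∀ ε → ½ ℚ.* ε ℚ.+ ½ ℚ.* ε ≡ ε
½+½ ε = trans (sym (ℚ.*-distribʳ-+ ε ½ ½)) (ℚ.*-identityˡ ε)

+-cauchy : ∀ a b c d → (a ℚ.+ b) ℚ.- (c ℚ.+ d) ≡ (a ℚ.- c) ℚ.+ (b ℚ.- d)
+-cauchy a b c d = trans (cong ((a ℚ.+ b) ℚ.+_) (ℚ.neg-distrib-+ c d))
  (interchange a b (ℚ.- c) (ℚ.- d))

neg-cauchy : ∀ a b → (ℚ.- a) ℚ.- (ℚ.- b) ≡ ℚ.- (a ℚ.- b)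
neg-cauchy a b = sym (ℚ.neg-distrib-+ a (ℚ.- b))

cancel : ∀ a b → a ≡ (a ℚ.- b) ℚ.+ b
cancel a b = sym (trans (ℚ.+-assoc a (ℚ.- b) b)
  (trans (cong (a ℚ.+_) (ℚ.+-inverseˡ b)) (ℚ.+-identityʳ a)))

telescope : ∀ a b c → a ℚ.- c ≡ (a ℚ.- b) ℚ.+ (b ℚ.- c)
telescope a b c = trans (cong (ℚ._- c) (cancel a b)) (ℚ.+-assoc (a ℚ.- b) b (ℚ.- c))

*-distribˡ-- : ∀ a b c → a ℚ.* b ℚ.- a ℚ.* c ≡ a ℚ.* (b ℚ.- c)
*-distribˡ-- a b c = trans (cong (a ℚ.* b ℚ.+_) (ℚ.neg-distribʳ-* a c))
  (sym (ℚ.*-distribˡ-+ a b (ℚ.- c)))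

*-cauchy : ∀ a b c d → a ℚ.* b ℚ.- c ℚ.* d ≡ a ℚ.* (b ℚ.- d) ℚ.+ d ℚ.* (a ℚ.- c)
*-cauchy a b c d = trans (telescope (a ℚ.* b) (a ℚ.* d) (c ℚ.* d))
  (cong₂ ℚ._+_ (*-distribˡ-- a b d)
    (trans (cong₂ ℚ._-_ (ℚ.*-comm a d) (ℚ.*-comm c d)) (*-distribˡ-- d a c)))

∣+∣<ε : ∀ {a b} ε → ℚ.∣ a ∣ ℚ.< ½ ℚ.* ε → ℚ.∣ b ∣ ℚ.< ½ ℚ.* ε → ℚ.∣ a ℚ.+ b ∣ ℚ.< ε
∣+∣<ε {a} {b} ε p q = ℚ.≤-<-trans (ℚ.∣p+q∣≤∣p∣+∣q∣ a b)
  (subst (ℚ.∣ a ∣ ℚ.+ ℚ.∣ b ∣ ℚ.<_) (½+½ ε) (ℚ.+-mono-< p q))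

bounded : ∀ x → ∃₂ λ B N → Positive B × (∀ {n} → N ℕ.≤ n → ℚ.∣ seq x n ∣ ℚ.< B)
bounded x with cauchy x 1ℚ
... | N , close = 1ℚ ℚ.+ ℚ.∣ seq x N ∣ , N
    , ℚ.pos+nonNeg⇒pos 1ℚ ℚ.∣ seq x N ∣ {{ℚ.∣-∣-nonNeg (seq x N)}}
    , λ {n} N≤n → ℚ.≤-<-trans
        (subst (λ a → ℚ.∣ a ∣ ℚ.≤ ℚ.∣ seq x n ℚ.- seq x N ∣ ℚ.+ ℚ.∣ seq x N ∣)
          (sym (cancel (seq x n) (seq x N)))
          (ℚ.∣p+q∣≤∣p∣+∣q∣ (seq x n ℚ.- seq x N) (seq x N)))
        (ℚ.+-monoˡ-< ℚ.∣ seq x N ∣ (close N≤n ℕ.≤-refl))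

scaled : ∀ B ε → .{{Positive B}} → .{{Positive ε}} →
         ∃ λ δ → Positive δ × (∀ a b → ℚ.∣ a ∣ ℚ.< B → ℚ.∣ b ∣ ℚ.< δ → ℚ.∣ a ℚ.* b ∣ ℚ.< ε)
scaled B ε {{B>0}} {{ε>0}} = B⁻¹ ℚ.* ε
  , ℚ.pos*pos⇒pos B⁻¹ {{ℚ.1/pos⇒pos B}} ε
  , λ a b a<B b<δ → ℚ.≤-<-trans
      (ℚ.≤-trans (ℚ.≤-reflexive (ℚ.∣p*q∣≡∣p∣*∣q∣ a b))
        (ℚ.*-monoʳ-≤-nonNeg ℚ.∣ b ∣ {{ℚ.∣-∣-nonNeg b}} (ℚ.<⇒≤ a<B)))
      (subst (B ℚ.* ℚ.∣ b ∣ ℚ.<_)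
        (trans (sym (ℚ.*-assoc B B⁻¹ ε))
          (trans (cong (ℚ._* ε) (ℚ.*-inverseʳ B {{ℚ.pos⇒nonZero B}})) (ℚ.*-identityˡ ε)))
        (ℚ.*-monoʳ-<-pos B b<δ))
  where
  B⁻¹ : ℚ
  B⁻¹ = (ℚ.1/ B) {{ℚ.pos⇒nonZero B}}

infixl 6 _+ℝ_ _-ℝ_
infixl 7 _*ℝ_
infix  8 -ℝ_

_+ℝ_ : ℝ → ℝ → ℝ
x +ℝ y = mkℝ (λ n → seq x n ℚ.+ seq y n) prf
  where
  prf : ∀ ε → .{{Positive ε}} → _
  prf ε with cauchy x (½ ℚ.* ε) {{½-pos ε}} | cauchy y (½ ℚ.* ε) {{½-pos ε}}
  ... | M , p | N , q = M ℕ.⊔ N , λ {m} {n} m≥ n≥ →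
    subst (λ d → ℚ.∣ d ∣ ℚ.< ε) (sym (+-cauchy (seq x m) (seq y m) (seq x n) (seq y n)))
      (∣+∣<ε ε (p (ℕ.m⊔n≤o⇒m≤o M N m≥) (ℕ.m⊔n≤o⇒m≤o M N n≥))
               (q (ℕ.m⊔n≤o⇒n≤o M N m≥) (ℕ.m⊔n≤o⇒n≤o M N n≥)))

-ℝ_ : ℝ → ℝ
-ℝ x = mkℝ (λ n → ℚ.- seq x n) prf
  where
  prf : ∀ ε → .{{Positive ε}} → _
  prf ε with cauchy x ε
  ... | N , p = N , λ {m} {n} m≥ n≥ →
    subst (ℚ._< ε)
      (sym (trans (cong ℚ.∣_∣ (neg-cauchy (seq x m) (seq x n))) (ℚ.∣-p∣≡∣p∣ (seq x m ℚ.- seq x n))))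
      (p m≥ n≥)

_-ℝ_ : ℝ → ℝ → ℝ
x -ℝ y = x +ℝ (-ℝ y)

_*ℝ_ : ℝ → ℝ → ℝ
x *ℝ y = mkℝ (λ n → seq x n ℚ.* seq y n) prf
  where
  prf : ∀ ε → .{{Positive ε}} → _
  prf ε with bounded x | bounded y
  ... | A , K , A>0 , ∣x∣<A | B , L , B>0 , ∣y∣<B
    with scaled A (½ ℚ.* ε) {{A>0}} {{½-pos ε}} | scaled B (½ ℚ.* ε) {{B>0}} {{½-pos ε}}
  ... | δ , δ>0 , small | η , η>0 , small′
    with cauchy y δ {{δ>0}} | cauchy x η {{η>0}}
  ... | M , q | N , p = (K ℕ.⊔ L) ℕ.⊔ (M ℕ.⊔ N) , λ {m} {n} m≥ n≥ →
    subst (λ d → ℚ.∣ d ∣ ℚ.< ε) (sym (*-cauchy (seq x m) (seq y m) (seq x n) (seq y n)))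
      (∣+∣<ε ε
        (small (seq x m) (seq y m ℚ.- seq y n)
          (∣x∣<A (ℕ.m⊔n≤o⇒m≤o K L (left m≥)))
          (q (ℕ.m⊔n≤o⇒m≤o M N (right m≥)) (ℕ.m⊔n≤o⇒m≤o M N (right n≥))))
        (small′ (seq y n) (seq x m ℚ.- seq x n)
          (∣y∣<B (ℕ.m⊔n≤o⇒n≤o K L (left n≥)))
          (p (ℕ.m⊔n≤o⇒n≤o M N (right m≥)) (ℕ.m⊔n≤o⇒n≤o M N (right n≥)))))
    where
    left : ∀ {k} → (K ℕ.⊔ L) ℕ.⊔ (M ℕ.⊔ N) ℕ.≤ k → K ℕ.⊔ L ℕ.≤ k
    left = ℕ.m⊔n≤o⇒m≤o (K ℕ.⊔ L) (M ℕ.⊔ N)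
    right : ∀ {k} → (K ℕ.⊔ L) ℕ.⊔ (M ℕ.⊔ N) ℕ.≤ k → M ℕ.⊔ N ℕ.≤ k
    right = ℕ.m⊔n≤o⇒n≤o (K ℕ.⊔ L) (M ℕ.⊔ N)

sumℝ : List ℝ → ℝ
sumℝ = foldr _+ℝ_ 0ℝ

Span : ∀ {X : Set} → Pred (X → ℝ) 0ℓ → Pred (X → ℝ) 0ℓ
Span {X} S f = ∃ λ (terms : List (ℝ × (X → ℝ))) →
  All (S ∘ proj₂) terms ×
  (∀ x → f x ≃ sumℝ (List.map (λ (c , g) → c *ℝ g x) terms))

average : ∀ {X : Set} → (X → ℝ) → List⁺ X → ℝ
average f (x ∷ xs) =
  fromℚ (+ 1 ℚ./ suc (List.length xs)) *ℝ sumℝ (List.map f (x ∷ xs))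

-- O lists, without repetition, the forward iterates of its first entry.
-- For a bijection of a finite set these are exactly the orbits.
IsOrbit : ∀ {X : Set} → (X → X) → List⁺ X → Set
IsOrbit {X} T O = Unique (List⁺.toList O) ×
  (∀ x → (x List.∈ List⁺.toList O) ⇔ (∃ λ k → (T ^ k) (List⁺.head O) ≡ x))
  where open Endo X using (_^_)

Homomesic : ∀ {X : Set} → (X → X) → (X → ℝ) → Set
Homomesic T f = ∃ λ c → ∀ O → IsOrbit T O → average f O ≃ c

x∉p-x : ∀ {n} (x : Fin n) (p : Subset n) → x ∉ p - x
x∉p-x Fin.zero    (inside  ∷ p) ()
x∉p-x Fin.zero    (outside ∷ p) ()
x∉p-x (Fin.suc x) (inside  ∷ p) (there h) = x∉p-x x p h
x∉p-x (Fin.suc x) (outside ∷ p) (there h) = x∉p-x x p h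

module Ideals {n : ℕ} {_≤_ : Rel (Fin n) 0ℓ} (≤-po : IsDecPartialOrder _≡_ _≤_) where
  open IsDecPartialOrder ≤-po using (_≤?_)

  Minimal Maximal : Fin n → Subset n → Set
  Minimal q S = q ∈ S × (∀ r → r ∈ S → r ≤ q → r ≡ q)
  Maximal q S = q ∈ S × (∀ r → r ∈ S → q ≤ r → r ≡ q)

  minimal? : ∀ q S → Dec (Minimal q S)
  minimal? q S =
    (q ∈? S) ×-dec Fin.all? (λ r → (r ∈? S) →-dec ((r ≤? q) →-dec (r Fin.≟ q)))

  maximal? : ∀ q S → Dec (Maximal q S)
  maximal? q S =
    (q ∈? S) ×-dec Fin.all? (λ r → (r ∈? S) →-dec ((q ≤? r) →-dec (r Fin.≟ q)))

  -- The closure proof is irrelevant, so that ideals with the same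
  -- elements are propositionally equal.
  record Ideal : Set where
    constructor mkIdeal
    field
      elements : Subset n
      .closed  : ∀ x y → x ≤ y → y ∈ elements → x ∈ elements

  open Ideal public

  insert : ∀ q (I : Ideal) → .(Minimal q (∁ (elements I))) → Ideal
  insert q (mkIdeal S c) m = mkIdeal (S ∪ ⁅ q ⁆) (prf c m)
    where
    prf : (∀ x y → x ≤ y → y ∈ S → x ∈ S) → Minimal q (∁ S) →
          ∀ x y → x ≤ y → y ∈ S ∪ ⁅ q ⁆ → x ∈ S ∪ ⁅ q ⁆
    prf c (_ , least) x y x≤y y∈ with x∈p∪q⁻ S ⁅ q ⁆ y∈
    ... | inj₁ y∈S = x∈p∪q⁺ (inj₁ (c x y x≤y y∈S))
    ... | inj₂ y∈q with x∈⁅y⁆⇒x≡y q y∈q | x ∈? S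
    ...   | refl | yes x∈S = x∈p∪q⁺ (inj₁ x∈S)
    ...   | refl | no  x∉S =
      x∈p∪q⁺ (inj₂ (subst (_∈ ⁅ q ⁆) (sym (least x (x∉p⇒x∈∁p x∉S) x≤y)) (x∈⁅x⁆ q)))

  remove : ∀ q (I : Ideal) → .(Maximal q (elements I)) → Ideal
  remove q (mkIdeal S c) m = mkIdeal (S - q) (prf c m)
    where
    prf : (∀ x y → x ≤ y → y ∈ S → x ∈ S) → Maximal q S →
          ∀ x y → x ≤ y → y ∈ S - q → x ∈ S - q
    prf c (_ , greatest) x y x≤y y∈ = x∈p∧x≢y⇒x∈p-y (c x y x≤y y∈S) λ x≡q →
      x∉p-x q S (subst (_∈ S - q) (greatest y y∈S (subst (_≤ y) x≡q x≤y)) y∈)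
      where y∈S = p─q⊆p S ⁅ q ⁆ y∈

  τ : Fin n → Ideal → Ideal
  τ q I with minimal? q (∁ (elements I)) | maximal? q (elements I)
  ... | yes m | _     = insert q I m
  ... | no  _ | yes m = remove q I m
  ... | no  _ | no  _ = I

  χ̂ : Fin n → Ideal → ℝ
  χ̂ q I with q ∈? elements I
  ... | yes _ = 1ℝ
  ... | no  _ = 0ℝ

  χ̂-if-any : {P : Fin n → Set} → Dec (∃ P) → Ideal → ℝ
  χ̂-if-any (yes (q , _)) = χ̂ q
  χ̂-if-any (no _)        = λ _ → 0ℝ

  -- q is the j-th smallest element of the chain {r | P r}.
  NthSmallest : {P : Fin n → Set} → (∀ r → Dec (P r)) → ℕ → Fin n → Set
  NthSmallest {P} P? j q =
    P q × List.length (filter (λ r → P? r ×-dec (r ≤? q)) (allFin n)) ≡ j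

-- The element of Fin n with toℕ value k stands for x_{k+1}.
label : ∀ {n} → Fin n → ℕ
label = suc ∘ toℕ

module Zigzag (n : ℕ) {Rising Falling : Pred ℕ 0ℓ}
              (rising? : ∀ j → Dec (Rising j)) (falling? : ∀ j → Dec (Falling j))
              (disjoint : ∀ {j} → Rising j → ¬ Falling j) where

  infix 4 _⋖_ _≤_

  _⋖_ : Rel (Fin n) 0ℓ
  x ⋖ y = (label y ≡ suc (label x) × Rising  (label x))
        ⊎ (label x ≡ suc (label y) × Falling (label y))

  _≤_ : Rel (Fin n) 0ℓ
  _≤_ = Star _⋖_

  Run : Pred ℕ 0ℓ → ℕ → ℕ → Set
  Run P a b = a ℕ.≤ b × (∀ {j} → j ℕ.< b → a ℕ.≤ j → P j)

  run? : ∀ {P} → (∀ j → Dec (P j)) → ∀ a b → Dec (Run P a b)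
  run? P? a b = (a ℕ.≤? b) ×-dec ℕ.allUpTo? (λ j → (a ℕ.≤? j) →-dec P? j) b

  run-refl : ∀ {P a} → Run P a a
  run-refl = ℕ.≤-refl , λ j<a a≤j → contradiction j<a (ℕ.≤⇒≯ a≤j)

  run-cons : ∀ {P a b} → P a → Run P (suc a) b → Run P a b
  run-cons {a = a} p (a<b , r) = ℕ.<⇒≤ a<b , step
    where
    step : ∀ {j} → j ℕ.< _ → a ℕ.≤ j → _
    step j<b a≤j with ℕ.m≤n⇒m<n∨m≡n a≤j
    ... | inj₁ a<j  = r j<b a<j
    ... | inj₂ refl = p

  run-snoc : ∀ {P a b} → Run P a b → P b → Run P a (suc b)
  run-snoc {b = b} (a≤b , r) p = ℕ.m≤n⇒m≤1+n a≤b , step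
    where
    step : ∀ {j} → j ℕ.< suc b → _ ℕ.≤ j → _
    step (s≤s j≤b) a≤j with ℕ.m≤n⇒m<n∨m≡n j≤b
    ... | inj₁ j<b  = r j<b a≤j
    ... | inj₂ refl = p

  Linked : Fin n → Fin n → Set
  Linked x y = Run Rising (label x) (label y) ⊎ Run Falling (label y) (label x)

  ≤⇒linked : ∀ {x y} → x ≤ y → Linked x y
  ≤⇒linked Star.ε = inj₁ run-refl
  ≤⇒linked {x} {y} (inj₁ (eq , up) ◅ z≤y) with ≤⇒linked z≤y
  ... | inj₁ r rewrite eq = inj₁ (run-cons up r)
  ... | inj₂ (y≤z , r) with ℕ.m≤n⇒m<n∨m≡n y≤z
  ...   | inj₂ y≡z = inj₁ (subst (Run Rising (label x)) (sym (trans y≡z eq)) (run-snoc run-refl up))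
  ...   | inj₁ y<z rewrite eq = contradiction (r ℕ.≤-refl (ℕ.≤-pred y<z)) (disjoint up)
  ≤⇒linked {x} {y} (_◅_ {j = z} (inj₂ (eq , down)) z≤y) with ≤⇒linked z≤y
  ... | inj₂ r rewrite eq = inj₂ (run-snoc r down)
  ... | inj₁ (z≤y′ , r) with ℕ.m≤n⇒m<n∨m≡n z≤y′
  ...   | inj₂ z≡y rewrite eq = inj₂ (subst (λ k → Run Falling k (suc (label z))) z≡y (run-snoc run-refl down))
  ...   | inj₁ z<y = contradiction down (disjoint (r z<y ℕ.≤-refl))

  climb : ∀ {P : Pred ℕ 0ℓ} {C : Rel (Fin n) 0ℓ} →
          (∀ {x y} → label y ≡ suc (label x) → P (label x) → C x y) →
          ∀ d {x y} → label y ≡ d ℕ.+ label x → Run P (label x) (label y) → Star C x y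
  climb step zero    {x} {y} eq _ with Fin.toℕ-injective (ℕ.suc-injective eq)
  ... | refl = Star.ε
  climb {P} {C} step (suc d) {x} {y} eq (x≤y , r) = step z≡ (r x<y ℕ.≤-refl) ◅
    climb step d (trans eq (trans (sym (ℕ.+-suc d (label x))) (cong (d ℕ.+_) (sym z≡))))
      ( subst (ℕ._≤ label y) (sym z≡) x<y
      , λ {j} j<y z≤j → r j<y (ℕ.<⇒≤ (subst (ℕ._≤ j) z≡ z≤j)))
    where
    x<y : label x ℕ.< label y
    x<y = subst (label x ℕ.<_) (sym eq) (s≤s (ℕ.m≤n+m (label x) d))
    bound : label x ℕ.< n
    bound = ℕ.<-≤-trans x<y (Fin.toℕ<n y)
    z : Fin n
    z = fromℕ< bound
    z≡ : label z ≡ suc (label x)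
    z≡ = cong suc (Fin.toℕ-fromℕ< bound)

  climb′ : ∀ {P : Pred ℕ 0ℓ} {C : Rel (Fin n) 0ℓ} →
           (∀ {x y} → label y ≡ suc (label x) → P (label x) → C x y) →
           ∀ {x y} → Run P (label x) (label y) → Star C x y
  climb′ step r = climb step _ (sym (ℕ.m∸n+n≡m (proj₁ r))) r

  linked⇒≤ : ∀ {x y} → Linked x y → x ≤ y
  linked⇒≤ (inj₁ r) = climb′ (λ eq up → inj₁ (eq , up)) r
  linked⇒≤ (inj₂ r) = reverse id
    (climb′ {C = λ x y → y ⋖ x} (λ eq down → inj₂ (eq , down)) r)

  antisym : ∀ {x y} → x ≤ y → y ≤ x → x ≡ y
  antisym {x} {y} x≤y y≤x with ≤⇒linked x≤y | ≤⇒linked y≤x | ℕ.<-cmp (label x) (label y)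
  ... | _ | _ | tri≈ _ eq _ = Fin.toℕ-injective (ℕ.suc-injective eq)
  ... | inj₁ (_ , r)   | inj₂ (_ , s)   | tri< lt _ _ =
    contradiction (s lt ℕ.≤-refl) (disjoint (r lt ℕ.≤-refl))
  ... | inj₂ (_ , s)   | inj₁ (_ , r)   | tri> _ _ gt =
    contradiction (s gt ℕ.≤-refl) (disjoint (r gt ℕ.≤-refl))
  ... | inj₂ (y≤x′ , _) | _             | tri< lt _ _ = contradiction lt (ℕ.≤⇒≯ y≤x′)
  ... | inj₁ (_ , _)   | inj₁ (y≤x′ , _) | tri< lt _ _ = contradiction lt (ℕ.≤⇒≯ y≤x′)
  ... | inj₁ (x≤y′ , _) | _             | tri> _ _ gt = contradiction gt (ℕ.≤⇒≯ x≤y′)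
  ... | inj₂ (_ , _)   | inj₂ (x≤y′ , _) | tri> _ _ gt = contradiction gt (ℕ.≤⇒≯ x≤y′)

  _≤?_ : Decidable _≤_
  x ≤? y = map′ linked⇒≤ ≤⇒linked
    (run? rising? (label x) (label y) ⊎-dec run? falling? (label y) (label x))

  ≤-isDecPartialOrder : IsDecPartialOrder _≡_ _≤_
  ≤-isDecPartialOrder = record
    { isPartialOrder = record
      { isPreorder = record
        { isEquivalence = isEquivalence
        ; reflexive     = λ { refl → Star.ε }
        ; trans         = _◅◅_
        }
      ; antisym = antisym
      }
    ; _≟_  = Fin._≟_
    ; _≤?_ = _≤?_
    }

partialSum : List ℕ → ℕ → ℕ
partialSum αs k = sum (List.take k αs)

partialSum-mono : ∀ αs {k l} → k ℕ.≤ l → partialSum αs k ℕ.≤ partialSum αs l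
partialSum-mono αs       z≤n       = z≤n
partialSum-mono []       (s≤s k≤l) = z≤n
partialSum-mono (α ∷ αs) (s≤s k≤l) = ℕ.+-monoʳ-≤ α (partialSum-mono αs k≤l)

module Fence {t : ℕ} (α : Vec ℕ t) where

  a : ℕ → ℕ
  a = partialSum (Vec.toList α)

  n : ℕ
  n = a t ∸ 1

  -- Segments are indexed from 0 in Fin t: the index i stands for segment
  -- S_{idx i}, whose labels run from a (toℕ i) to a (idx i).
  idx : Fin t → ℕ
  idx i = suc (toℕ i)

  Between : Parity → Pred ℕ 0ℓ
  Between p j = ∃ λ i → ℕ.parity (idx i) ≡ p × a (toℕ i) ℕ.≤ j × j ℕ.< a (idx i)

  between? : ∀ p j → Dec (Between p j)
  between? p j = Fin.any? λ i →
    (ℕ.parity (idx i) ℙ.≟ p) ×-dec ((a (toℕ i) ℕ.≤? j) ×-dec (j ℕ.<? a (idx i)))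

  separate : ∀ {i k j} → i ℕ.< k → j ℕ.< a (suc i) → ¬ (a k ℕ.≤ j)
  separate i<k j< ak≤j =
    ℕ.<⇒≱ j< (ℕ.≤-trans (partialSum-mono (Vec.toList α) i<k) ak≤j)

  disjoint : ∀ {j} → Between 1ℙ j → ¬ Between 0ℙ j
  disjoint (i , odd , lo , hi) (k , even , lo′ , hi′) with ℕ.<-cmp (toℕ i) (toℕ k)
  ... | tri< i<k _ _ = separate i<k hi lo′
  ... | tri> _ _ k<i = separate k<i hi′ lo
  ... | tri≈ _ i≡k _ with trans (sym odd) (trans (cong (ℕ.parity ∘ suc) i≡k) even)
  ...   | ()

  open Zigzag n (between? 1ℙ) (between? 0ℙ) disjoint public
  open Ideals ≤-isDecPartialOrder public

  -- At both ends this agrees with S₁ = {x_j : 1 ≤ j ≤ a₁} and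
  -- S_t = {x_j : a_{t-1} ≤ j ≤ n}, since labels lie between 1 and n.
  _∈Seg_ : Fin n → Fin t → Set
  q ∈Seg i = a (toℕ i) ℕ.≤ label q × label q ℕ.≤ a (idx i)

  _∈Seg?_ : ∀ q i → Dec (q ∈Seg i)
  q ∈Seg? i = (a (toℕ i) ℕ.≤? label q) ×-dec (label q ℕ.≤? a (idx i))

  -- Here k ranges over 1 ≤ k ≤ t - 1.
  SharedAt : Fin n → Fin t → Set
  SharedAt q k = 1 ℕ.≤ toℕ k × label q ≡ a (toℕ k)

  sharedAt? : ∀ q k → Dec (SharedAt q k)
  sharedAt? q k = (1 ℕ.≤? toℕ k) ×-dec (label q ℕ.≟ a (toℕ k))

  Shared Peak Valley : Fin n → Set
  Shared q = ∃ λ k → SharedAt q k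
  Peak   q = ∃ λ k → SharedAt q k × ℕ.parity (toℕ k) ≡ 1ℙ
  Valley q = ∃ λ k → SharedAt q k × ℕ.parity (toℕ k) ≡ 0ℙ

  shared? : ∀ q → Dec (Shared q)
  shared? q = Fin.any? (sharedAt? q)

  peak? : ∀ q → Dec (Peak q)
  peak? q = Fin.any? λ k → sharedAt? q k ×-dec (ℕ.parity (toℕ k) ℙ.≟ 1ℙ)

  valley? : ∀ q → Dec (Valley q)
  valley? q = Fin.any? λ k → sharedAt? q k ×-dec (ℕ.parity (toℕ k) ℙ.≟ 0ℙ)

  _∈S̆_ : Fin n → Fin t → Set
  q ∈S̆ i = q ∈Seg i × ¬ Shared q

  _∈S̆?_ : ∀ q i → Dec (q ∈S̆ i)
  q ∈S̆? i = (q ∈Seg? i) ×-dec ¬? (shared? q)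

  χ̂-peak χ̂-valley : Fin t → Ideal → ℝ
  χ̂-peak   i = χ̂-if-any (Fin.any? λ q → peak?   q ×-dec (q ∈Seg? i))
  χ̂-valley i = χ̂-if-any (Fin.any? λ q → valley? q ×-dec (q ∈Seg? i))

  β : Fin t → ℕ
  β i = lookup α i ∸ 1

  -- s is s_(i,j).
  segmentStat : Fin t → ℕ → Fin n → Ideal → ℝ
  segmentStat i j s I =
    fromℕ (lookup α i) *ℝ χ̂ s I
      -ℝ fromℕ j *ℝ χ̂-peak i I
      -ℝ (fromℕ (lookup α i) -ℝ fromℕ j) *ℝ χ̂-valley i I

  data Generator : Pred (Ideal → ℝ) 0ℓ where
    generator : ∀ i j s → 1 ℕ.≤ j → j ℕ.≤ β i → NthSmallest (_∈S̆? i) j s →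
                Generator (segmentStat i j s)

  -- x₁ is toggled first.
  Pro : Ideal → Ideal
  Pro = foldl (λ g q → τ q ∘ g) id (allFin n)

{-# OPTIONS --safe #-}
-- Let q be an unshared element and l, r its two neighbours along the zigzag.  In an
-- ideal the indicators of a rising or falling triple l, q, r are monotone, so toggling q
-- replaces χ(q) by χ(l) + χ(r) − χ(q).  When promotion reaches q, one neighbour has
-- already been updated and the other has not; summing over an orbit, where old and
-- new values have the same total, gives 2 S(q) = S(l) + S(r).  The totals along a
-- segment hence form an arithmetic progression between its two ends.  At an end
-- without a shared element a virtual neighbour with constant indicator takes
-- over, which only contributes a constant to the average.
module Submission where

open import Defs
open import Algebra.Bundles using (CommutativeMonoid)
open import Data.Bool using (if_then_else_)
open import Data.Fin as Fin using (Fin; toℕ; fromℕ<)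
import Data.Fin.Properties as Fin
open import Data.Fin.Subset as Subset using (∁; _∪_; ⁅_⁆; _-_)
open import Data.Fin.Subset.Properties as Subset using (_∈?_)
import Data.Integer as ℤ
import Data.Integer.Properties as ℤ
open import Data.List as List
  using (List; []; _∷_; _++_; map; foldl; foldr; filter; tabulate; allFin; length)
import Data.List.Properties as List
open import Data.List.Membership.Propositional using (_∈_)
open import Data.List.Membership.Propositional.Properties
  using (∈-map⁺; ∈-map⁻; ∈-∃++; ∈-allFin; ∈-insert)
open import Data.List.Membership.Propositional.Properties.WithK using (unique∧set⇒bag)
open import Data.List.NonEmpty as List⁺ using (List⁺; _∷_)
open import Data.List.Relation.Binary.BagAndSetEquality using (∼bag⇒↭)
open import Data.List.Relation.Binary.Permutation.Propositional using (_↭_)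
import Data.List.Relation.Binary.Permutation.Propositional.Properties as Perm
open import Data.List.Relation.Unary.All as ListAll using ([]; _∷_)
open import Data.List.Relation.Unary.AllPairs as AllPairs using (AllPairs; []; _∷_)
import Data.List.Relation.Unary.AllPairs.Properties as AllPairs
import Data.List.Relation.Unary.Any as Any
open import Data.List.Relation.Unary.Any.Properties using (lookup-index)
import Data.List.Relation.Unary.Unique.Propositional.Properties as Unique
open import Data.Nat as ℕ using (ℕ; zero; suc; _+_; _*_; _∸_; _≤_; _<_; z≤n; s≤s)
open import Data.Nat.ListAction using (sum)
open import Data.Nat.ListAction.Properties using (sum-↭)
import Data.Nat.Properties as ℕ
import Data.Nat.Solver as ℕSolver
open import Data.Parity.Base using (Parity; 0ℙ; 1ℙ; _⁻¹)
import Data.Parity.Properties as ℙ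
open import Data.Product using (∃; ∃₂; _×_; _,_; proj₁; proj₂)
open import Data.Rational as ℚ using (ℚ; 0ℚ; 1ℚ; ½)
import Data.Rational.Properties as ℚ
import Data.Rational.Solver as ℚSolver
open import Data.Rational.Unnormalised as ℚᵘ using (mkℚᵘ; *≡*)
import Data.Rational.Unnormalised.Properties as ℚᵘ
open import Data.Sum using (_⊎_; inj₁; inj₂)
open import Data.Vec as Vec using (Vec; []; _∷_; lookup; head; last)
open import Data.Vec.Relation.Unary.All using (All)
import Data.Vec.Relation.Unary.All.Properties as Vec
open import Function using (id; _∘_; _⇔_; mk⇔; Equivalence; Injective)
import Function.Endo.Propositional as Endo
open import Level using (0ℓ)
open import Relation.Binary using (Rel; IsDecPartialOrder; tri<; tri≈; tri>)
open import Relation.Binary.Construct.Closure.ReflexiveTransitive as Star using (_◅_)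
open import Relation.Binary.PropositionalEquality hiding (J)
open import Relation.Nullary using (¬_; Dec; yes; no; does; contradiction)
open import Relation.Nullary.Decidable using (recompute; _×-dec_)
open import Relation.Unary using (Pred; Decidable)

open import Algebra.Properties.CommutativeSemigroup (CommutativeMonoid.commutativeSemigroup ℚ.*-1-commutativeMonoid)
  using (x∙yz≈y∙xz)

-- The real numbers are only a thin outer layer. A generator takes constant rational sequences as
-- values, but the coefficients of a span are arbitrary Cauchy sequences, so a combination is
-- compared with its mean at each index separately; `≃` proper is needed only to replace `f` by the
-- combination. Division is postponed in the same spirit: orbit sums are compared with multiples of
-- the orbit length, and the arithmetic progressions live in ℕ with all differences moved to the
-- other side. The values of the virtual ends are forced: an absent cover relation never blocks a
-- toggle, so a missing lower neighbour behaves like an element that is always present and a missing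
-- upper one like an element that is always absent. A virtual top thus has the value 0 that the
-- statistic already assigns to a missing peak, while a virtual bottom has the value 1 where the
-- statistic assigns 0 to a missing valley. This discrepancy is the source of all nonzero averages.

-- Natural numbers in ℚ and finite sums

↑ : ℕ → ℚ
↑ k = ℤ.+ k ℚ./ 1

-- Rational addition normalises by a gcd that does not reduce for variables; among unnormalised
-- fractions the claim is a cross multiplication with denominators 1.
↑-+ : ∀ k l → ↑ (k + l) ≡ ↑ k ℚ.+ ↑ l
↑-+ k l = ℚ.toℚᵘ-injective (begin
  ℚ.toℚᵘ (↑ (k + l))              ≈⟨ ℚ.toℚᵘ-fromℚᵘ (mkℚᵘ (ℤ.+ (k + l)) 0) ⟩
  mkℚᵘ (ℤ.+ (k + l)) 0            ≈⟨ *≡* (cong (ℤ._* ℤ.+ 1)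
    (sym (cong₂ ℤ._+_ (ℤ.*-identityʳ (ℤ.+ k)) (ℤ.*-identityʳ (ℤ.+ l))))) ⟩
  mkℚᵘ (ℤ.+ k) 0 ℚᵘ.+ mkℚᵘ (ℤ.+ l) 0
    ≈⟨ ℚᵘ.+-cong (ℚ.toℚᵘ-fromℚᵘ (mkℚᵘ (ℤ.+ k) 0)) (ℚ.toℚᵘ-fromℚᵘ (mkℚᵘ (ℤ.+ l) 0)) ⟨
  ℚ.toℚᵘ (↑ k) ℚᵘ.+ ℚ.toℚᵘ (↑ l)  ≈⟨ ℚ.toℚᵘ-homo-+ (↑ k) (↑ l) ⟨
  ℚ.toℚᵘ (↑ k ℚ.+ ↑ l)            ∎)
  where open ℚᵘ.≃-Reasoning

↑-* : ∀ k l → ↑ (k * l) ≡ ↑ k ℚ.* ↑ l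
↑-* zero    l = sym (ℚ.*-zeroˡ (↑ l))
↑-* (suc k) l = begin
  ↑ (l + k * l)               ≡⟨ ↑-+ l (k * l) ⟩
  ↑ l ℚ.+ ↑ (k * l)           ≡⟨ cong₂ ℚ._+_ (sym (ℚ.*-identityˡ (↑ l))) (↑-* k l) ⟩
  1ℚ ℚ.* ↑ l ℚ.+ ↑ k ℚ.* ↑ l  ≡⟨ ℚ.*-distribʳ-+ (↑ l) 1ℚ (↑ k) ⟨
  (1ℚ ℚ.+ ↑ k) ℚ.* ↑ l        ≡⟨ cong (ℚ._* ↑ l) (↑-+ 1 k) ⟨
  ↑ (suc k) ℚ.* ↑ l           ∎
  where open ≡-Reasoning

1/suc*↑suc : ∀ k → (ℤ.+ 1 ℚ./ suc k) ℚ.* ↑ (suc k) ≡ 1ℚ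
1/suc*↑suc k = ℚ.toℚᵘ-injective (begin
  ℚ.toℚᵘ ((ℤ.+ 1 ℚ./ suc k) ℚ.* ↑ (suc k))
    ≈⟨ ℚ.toℚᵘ-homo-* (ℤ.+ 1 ℚ./ suc k) (↑ (suc k)) ⟩
  ℚ.toℚᵘ (ℤ.+ 1 ℚ./ suc k) ℚᵘ.* ℚ.toℚᵘ (↑ (suc k))
    ≈⟨ ℚᵘ.*-cong (ℚ.toℚᵘ-fromℚᵘ (mkℚᵘ (ℤ.+ 1) k)) (ℚ.toℚᵘ-fromℚᵘ (mkℚᵘ (ℤ.+ suc k) 0)) ⟩
  mkℚᵘ (ℤ.+ 1) k ℚᵘ.* mkℚᵘ (ℤ.+ suc k) 0
    ≈⟨ *≡* (trans (ℤ.*-identityʳ (ℤ.+ 1 ℤ.* ℤ.+ suc k))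
         (cong (λ d → ℤ.+ 1 ℤ.* ℤ.+ d) (sym (ℕ.*-identityʳ (suc k))))) ⟩
  mkℚᵘ (ℤ.+ 1) 0 ∎)
  where open ℚᵘ.≃-Reasoning

sumℚ : List ℚ → ℚ
sumℚ = foldr ℚ._+_ 0ℚ

module _ {X : Set} where

  sum-map-+ : ∀ (f g : X → ℕ) xs →
              sum (map (λ x → f x + g x) xs) ≡ sum (map f xs) + sum (map g xs)
  sum-map-+ f g []       = refl
  sum-map-+ f g (x ∷ xs) rewrite sum-map-+ f g xs =
    solve 4 (λ a b c d → (a :+ b) :+ (c :+ d) := (a :+ c) :+ (b :+ d)) refl
      (f x) (g x) (sum (map f xs)) (sum (map g xs))
    where open ℕSolver.+-*-Solver

  sum-map-const : ∀ c (xs : List X) → sum (map (λ _ → c) xs) ≡ c * length xs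
  sum-map-const c []       = sym (ℕ.*-zeroʳ c)
  sum-map-const c (x ∷ xs) = trans (cong (c +_) (sum-map-const c xs)) (sym (ℕ.*-suc c (length xs)))

  sumℚ-map-+ : ∀ (f g : X → ℚ) xs →
               sumℚ (map (λ x → f x ℚ.+ g x) xs) ≡ sumℚ (map f xs) ℚ.+ sumℚ (map g xs)
  sumℚ-map-+ f g []       = refl
  sumℚ-map-+ f g (x ∷ xs) rewrite sumℚ-map-+ f g xs =
    solve 4 (λ a b c d → (a :+ b) :+ (c :+ d) := (a :+ c) :+ (b :+ d)) refl
      (f x) (g x) (sumℚ (map f xs)) (sumℚ (map g xs))
    where open ℚSolver.+-*-Solver

  sumℚ-map-* : ∀ c (f : X → ℚ) xs → sumℚ (map (λ x → c ℚ.* f x) xs) ≡ c ℚ.* sumℚ (map f xs)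
  sumℚ-map-* c f []       = sym (ℚ.*-zeroʳ c)
  sumℚ-map-* c f (x ∷ xs) = trans (cong (c ℚ.* f x ℚ.+_) (sumℚ-map-* c f xs))
    (sym (ℚ.*-distribˡ-+ c (f x) (sumℚ (map f xs))))

  sumℚ-map-neg : ∀ (f : X → ℚ) xs → sumℚ (map (λ x → ℚ.- f x) xs) ≡ ℚ.- sumℚ (map f xs)
  sumℚ-map-neg f []       = refl
  sumℚ-map-neg f (x ∷ xs) = trans (cong (ℚ.- f x ℚ.+_) (sumℚ-map-neg f xs))
    (sym (ℚ.neg-distrib-+ (f x) (sumℚ (map f xs))))

  sumℚ-map-↑ : ∀ (f : X → ℕ) xs → sumℚ (map (λ x → ↑ (f x)) xs) ≡ ↑ (sum (map f xs))
  sumℚ-map-↑ f []       = refl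
  sumℚ-map-↑ f (x ∷ xs) = trans (cong (↑ (f x) ℚ.+_) (sumℚ-map-↑ f xs))
    (sym (↑-+ (f x) (sum (map f xs))))

-- Equality of Cauchy reals

pointwise⇒≃ : ∀ x y → (∀ k → seq x k ≡ seq y k) → x ≃ y
pointwise⇒≃ x y eq ε {{ε>0}} = 0 , λ {k} _ →
  subst (λ d → ℚ.∣ d ∣ ℚ.< ε)
    (sym (trans (cong (ℚ._- seq y k) (eq k)) (ℚ.+-inverseʳ (seq y k))))
    (ℚ.positive⁻¹ ε {{ε>0}})

≃-trans : ∀ x y z → x ≃ y → y ≃ z → x ≃ z
≃-trans x y z x≃y y≃z ε with x≃y (½ ℚ.* ε) {{½-pos ε}} | y≃z (½ ℚ.* ε) {{½-pos ε}}
... | M , p | N , q = M ℕ.⊔ N , λ {k} k≥ →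
  subst (λ d → ℚ.∣ d ∣ ℚ.< ε) (sym (telescope (seq x k) (seq y k) (seq z k)))
    (∣+∣<ε ε (p (ℕ.m⊔n≤o⇒m≤o M N k≥)) (q (ℕ.m⊔n≤o⇒n≤o M N k≥)))

+ℝ-cong : ∀ x x′ y y′ → x ≃ x′ → y ≃ y′ → x +ℝ y ≃ x′ +ℝ y′
+ℝ-cong x x′ y y′ x≃ y≃ ε with x≃ (½ ℚ.* ε) {{½-pos ε}} | y≃ (½ ℚ.* ε) {{½-pos ε}}
... | M , p | N , q = M ℕ.⊔ N , λ {k} k≥ →
  subst (λ d → ℚ.∣ d ∣ ℚ.< ε) (sym (+-cauchy (seq x k) (seq y k) (seq x′ k) (seq y′ k)))
    (∣+∣<ε ε (p (ℕ.m⊔n≤o⇒m≤o M N k≥)) (q (ℕ.m⊔n≤o⇒n≤o M N k≥)))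

*ℝ-congˡ : ∀ z x y → x ≃ y → z *ℝ x ≃ z *ℝ y
*ℝ-congˡ z x y x≃y ε with bounded z
... | B , M , B>0 , ∣z∣<B with scaled B ε {{B>0}}
...   | δ , δ>0 , small with x≃y δ {{δ>0}}
...     | N , p = M ℕ.⊔ N , λ {k} k≥ →
  subst (λ d → ℚ.∣ d ∣ ℚ.< ε) (sym (*-distribˡ-- (seq z k) (seq x k) (seq y k)))
    (small (seq z k) (seq x k ℚ.- seq y k)
      (∣z∣<B (ℕ.m⊔n≤o⇒m≤o M N k≥)) (p (ℕ.m⊔n≤o⇒n≤o M N k≥)))

-- Averages and homomesy of spans

module _ {X : Set} where

  sumℝ-map-cong : ∀ (f g : X → ℝ) → (∀ x → f x ≃ g x) → ∀ xs → sumℝ (map f xs) ≃ sumℝ (map g xs)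
  sumℝ-map-cong f g f≃g []       = pointwise⇒≃ 0ℝ 0ℝ λ _ → refl
  sumℝ-map-cong f g f≃g (x ∷ xs) =
    +ℝ-cong (f x) (g x) (sumℝ (map f xs)) (sumℝ (map g xs)) (f≃g x) (sumℝ-map-cong f g f≃g xs)

  average-cong : ∀ (f g : X → ℝ) → (∀ x → f x ≃ g x) → ∀ O → average f O ≃ average g O
  average-cong f g f≃g (x ∷ xs) = *ℝ-congˡ (fromℚ (ℤ.+ 1 ℚ./ suc (length xs)))
    (sumℝ (map f (x ∷ xs))) (sumℝ (map g (x ∷ xs))) (sumℝ-map-cong f g f≃g (x ∷ xs))

  seq-sumℝ : ∀ (f : X → ℝ) xs k → seq (sumℝ (map f xs)) k ≡ sumℚ (map (λ x → seq (f x) k) xs)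
  seq-sumℝ f []       k = refl
  seq-sumℝ f (x ∷ xs) k = cong (seq (f x) k ℚ.+_) (seq-sumℝ f xs k)

  -- The property demanded of generators: values represented by constant sequences, and orbit sums
  -- proportional to the orbit length. Both are exact equations in ℚ, which survive multiplication
  -- by the separate terms of a real coefficient.
  RationallyHomomesic : (X → X) → (X → ℝ) → Set
  RationallyHomomesic T g = ∃₂ λ (G : X → ℚ) (c : ℚ) →
    (∀ x k → seq (g x) k ≡ G x) ×
    (∀ O → IsOrbit T O → sumℚ (map G (List⁺.toList O)) ≡ c ℚ.* ↑ (List⁺.length O))

  module _ {T : X → X} {S : Pred (X → ℝ) 0ℓ} (hom : ∀ {g} → S g → RationallyHomomesic T g) where

    private
      combination : List (ℝ × (X → ℝ)) → X → ℝ
      combination terms x = sumℝ (map (λ (c , g) → c *ℝ g x) terms)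

    mean : ∀ {terms} → ListAll.All (S ∘ proj₂) terms → ℝ
    mean []                        = 0ℝ
    mean {(a , _) ∷ _} (Sg ∷ Sgs) = a *ℝ fromℚ (proj₁ (proj₂ (hom Sg))) +ℝ mean Sgs

    -- At a fixed index `k` each coefficient is the single rational `seq a k`, so linearity of
    -- finite sums in ℚ suffices and no limit is involved.
    sum-combination : ∀ {terms} (Sgs : ListAll.All (S ∘ proj₂) terms) O → IsOrbit T O → ∀ k →
      sumℚ (map (λ x → seq (combination terms x) k) (List⁺.toList O))
        ≡ seq (mean Sgs) k ℚ.* ↑ (List⁺.length O)
    sum-combination [] O _ k = begin
      sumℚ (map (λ _ → ↑ 0) (List⁺.toList O))          ≡⟨ sumℚ-map-↑ (λ _ → 0) (List⁺.toList O) ⟩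
      ↑ (sum (map (λ _ → 0) (List⁺.toList O)))         ≡⟨ cong ↑ (sum-map-const 0 (List⁺.toList O)) ⟩
      0ℚ                                               ≡⟨ ℚ.*-zeroˡ (↑ (List⁺.length O)) ⟨
      0ℚ ℚ.* ↑ (List⁺.length O)                        ∎
      where open ≡-Reasoning
    sum-combination {(a , g) ∷ terms} (Sg ∷ Sgs) O orb k = begin
      sumℚ (map (λ x → seq a k ℚ.* seq (g x) k ℚ.+ rest x) xs)
        ≡⟨ sumℚ-map-+ (λ x → seq a k ℚ.* seq (g x) k) rest xs ⟩
      sumℚ (map (λ x → seq a k ℚ.* seq (g x) k) xs) ℚ.+ sumℚ (map rest xs)
        ≡⟨ cong₂ ℚ._+_ (sumℚ-map-* (seq a k) (λ x → seq (g x) k) xs) (sum-combination Sgs O orb k) ⟩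
      seq a k ℚ.* sumℚ (map (λ x → seq (g x) k) xs) ℚ.+ seq (mean Sgs) k ℚ.* N
        ≡⟨ cong (λ ys → seq a k ℚ.* sumℚ ys ℚ.+ seq (mean Sgs) k ℚ.* N)
             (List.map-cong (λ x → proj₁ (proj₂ (proj₂ (hom Sg))) x k) xs) ⟩
      seq a k ℚ.* sumℚ (map G xs) ℚ.+ seq (mean Sgs) k ℚ.* N
        ≡⟨ cong (λ s → seq a k ℚ.* s ℚ.+ seq (mean Sgs) k ℚ.* N) (proj₂ (proj₂ (proj₂ (hom Sg))) O orb) ⟩
      seq a k ℚ.* (c ℚ.* N) ℚ.+ seq (mean Sgs) k ℚ.* N
        ≡⟨ cong (ℚ._+ seq (mean Sgs) k ℚ.* N) (sym (ℚ.*-assoc (seq a k) c N)) ⟩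
      seq a k ℚ.* c ℚ.* N ℚ.+ seq (mean Sgs) k ℚ.* N
        ≡⟨ ℚ.*-distribʳ-+ N (seq a k ℚ.* c) (seq (mean Sgs) k) ⟨
      (seq a k ℚ.* c ℚ.+ seq (mean Sgs) k) ℚ.* N ∎
      where
      open ≡-Reasoning
      xs = List⁺.toList O
      N = ↑ (List⁺.length O)
      G = proj₁ (hom Sg)
      c = proj₁ (proj₂ (hom Sg))
      rest = λ x → seq (combination terms x) k

    span-homomesic : ∀ f → Span S f → Homomesic T f
    span-homomesic f (terms , Sgs , f≃) = mean Sgs , λ O orb →
      ≃-trans (average f O) (average (combination terms) O) (mean Sgs)
        (average-cong f (combination terms) f≃ O)
        (pointwise⇒≃ (average (combination terms) O) (mean Sgs) (average≡ O orb))
      where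
      average≡ : ∀ O → IsOrbit T O → ∀ k → seq (average (combination terms) O) k ≡ seq (mean Sgs) k
      average≡ O@(x ∷ xs) orb k = begin
        1/N ℚ.* seq (sumℝ (map (combination terms) (x ∷ xs))) k
          ≡⟨ cong (1/N ℚ.*_) (trans (seq-sumℝ (combination terms) (x ∷ xs) k) (sum-combination Sgs O orb k)) ⟩
        1/N ℚ.* (seq (mean Sgs) k ℚ.* N)
          ≡⟨ x∙yz≈y∙xz 1/N (seq (mean Sgs) k) N ⟩
        seq (mean Sgs) k ℚ.* (1/N ℚ.* N)
          ≡⟨ cong (seq (mean Sgs) k ℚ.*_) (1/suc*↑suc (length xs)) ⟩
        seq (mean Sgs) k ℚ.* 1ℚ
          ≡⟨ ℚ.*-identityʳ (seq (mean Sgs) k) ⟩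
        seq (mean Sgs) k ∎
        where
        open ≡-Reasoning
        1/N = ℤ.+ 1 ℚ./ suc (length xs)
        N = ↑ (suc (length xs))

  -- Orbits of an injective map

  module _ {T : X → X} (T-injective : Injective _≡_ _≡_ T) where
    open Endo X using (_^_)

    ^-cancel : ∀ k {l} x → (T ^ k) x ≡ (T ^ (k + suc l)) x → x ≡ (T ^ suc l) x
    ^-cancel zero    x eq = eq
    ^-cancel (suc k) x eq = ^-cancel k x (T-injective eq)

    -- Injectivity keeps the image list free of repetitions, and two such lists with the same
    -- members are permutations of each other. The members agree because the head, being on a finite
    -- forward orbit of an injective map, is itself an image.
    orbit-map-↭ : ∀ O → IsOrbit T O → map T (List⁺.toList O) ↭ List⁺.toList O
    orbit-map-↭ O@(h ∷ _) (unique , reach) =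
      ∼bag⇒↭ (unique∧set⇒bag (Unique.map⁺ T-injective unique) unique (mk⇔ to from))
      where
      xs = List⁺.toList O

      to : ∀ {x} → x ∈ map T xs → x ∈ xs
      to x∈ with ∈-map⁻ T x∈
      ... | y , y∈ , refl with Equivalence.to (reach y) y∈
      ...   | k , refl = Equivalence.from (reach _) (suc k , refl)

      -- One more iterate of `h` than `xs` has entries: by the pigeonhole principle two of them
      -- share a position and hence coincide, and `^-cancel` strips the common iterations.
      position : Fin (suc (length xs)) → Fin (length xs)
      position k = Any.index (Equivalence.from (reach _) (toℕ k , refl))

      returns : ∃ λ k → h ≡ (T ^ suc k) h
      returns with Fin.pigeonhole (ℕ.n<1+n (length xs)) position
      ... | i , j , i<j , same with ℕ.m≤n⇒∃[o]m+o≡n i<j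
      ...   | l , eq = l , ^-cancel (toℕ i) h (trans
              (trans (lookup-index (Equivalence.from (reach _) (toℕ i , refl)))
                (trans (cong (List.lookup xs) same)
                  (sym (lookup-index (Equivalence.from (reach _) (toℕ j , refl))))))
              (cong (λ k → (T ^ k) h) (sym (trans (ℕ.+-suc (toℕ i) l) eq))))

      from : ∀ {x} → x ∈ xs → x ∈ map T xs
      from {x} x∈ with Equivalence.to (reach x) x∈
      ... | suc k , refl = ∈-map⁺ T (Equivalence.from (reach _) (k , refl))
      -- Only the head is not visibly an image; its return after a positive number of steps supplies
      -- a preimage.
      ... | zero  , refl with returns
      ...   | k , eq = subst (_∈ map T xs) (sym eq) (∈-map⁺ T (Equivalence.from (reach _) (k , refl)))

    orbit-sum : ∀ (f : X → ℕ) O → IsOrbit T O →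
                sum (map (f ∘ T) (List⁺.toList O)) ≡ sum (map f (List⁺.toList O))
    orbit-sum f O orb = trans (cong sum (List.map-∘ (List⁺.toList O)))
      (sum-↭ (Perm.map⁺ f (orbit-map-↭ O orb)))

sumℚ-map-linear : ∀ {X : Set} p q r (f g h : X → ℕ) xs →
  sumℚ (map (λ x → p ℚ.* ↑ (f x) ℚ.- q ℚ.* ↑ (g x) ℚ.- r ℚ.* ↑ (h x)) xs) ≡
  p ℚ.* ↑ (sum (map f xs)) ℚ.- q ℚ.* ↑ (sum (map g xs)) ℚ.- r ℚ.* ↑ (sum (map h xs))
sumℚ-map-linear p q r f g h xs = begin
  sumℚ (map (λ x → pf x ℚ.- qg x ℚ.- rh x) xs)
    ≡⟨ sumℚ-map-+ (λ x → pf x ℚ.- qg x) (λ x → ℚ.- rh x) xs ⟩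
  sumℚ (map (λ x → pf x ℚ.- qg x) xs) ℚ.+ sumℚ (map (λ x → ℚ.- rh x) xs)
    ≡⟨ cong₂ ℚ._+_ (sumℚ-map-+ pf (λ x → ℚ.- qg x) xs) (negated r h) ⟩
  sumℚ (map pf xs) ℚ.+ sumℚ (map (λ x → ℚ.- qg x) xs) ℚ.- r ℚ.* ↑ (sum (map h xs))
    ≡⟨ cong₂ (λ s t → s ℚ.+ t ℚ.- r ℚ.* ↑ (sum (map h xs))) (scaled-sum p f) (negated q g) ⟩
  p ℚ.* ↑ (sum (map f xs)) ℚ.- q ℚ.* ↑ (sum (map g xs)) ℚ.- r ℚ.* ↑ (sum (map h xs)) ∎
  where
  open ≡-Reasoning
  pf qg rh : _ → ℚ
  pf x = p ℚ.* ↑ (f x)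
  qg x = q ℚ.* ↑ (g x)
  rh x = r ℚ.* ↑ (h x)
  scaled-sum : ∀ c (k : _ → ℕ) → sumℚ (map (λ x → c ℚ.* ↑ (k x)) xs) ≡ c ℚ.* ↑ (sum (map k xs))
  scaled-sum c k = trans (sumℚ-map-* c (λ x → ↑ (k x)) xs) (cong (c ℚ.*_) (sumℚ-map-↑ k xs))
  negated : ∀ c (k : _ → ℕ) → sumℚ (map (λ x → ℚ.- (c ℚ.* ↑ (k x))) xs) ≡ ℚ.- (c ℚ.* ↑ (sum (map k xs)))
  negated c k = trans (sumℚ-map-neg (λ x → c ℚ.* ↑ (k x)) xs) (cong ℚ.-_ (scaled-sum c k))

-- Here `x`, `y`, `z` stand for orbit sums of the element, the peak and the valley, and `N` for the
-- orbit length. The numbers `c` and `d` are what a virtual end adds per ideal; collecting them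
-- leaves a multiple of `N`.
balance : ∀ p q r x y z N c d → p ℚ.* x ≡ q ℚ.* (y ℚ.+ c ℚ.* N) ℚ.+ r ℚ.* (z ℚ.+ d ℚ.* N) →
          p ℚ.* x ℚ.- q ℚ.* y ℚ.- r ℚ.* z ≡ (q ℚ.* c ℚ.+ r ℚ.* d) ℚ.* N
balance p q r x y z N c d eq = trans (cong (λ s → s ℚ.- q ℚ.* y ℚ.- r ℚ.* z) eq)
  (solve 7 (λ q r y z N c d → q :* (y :+ c :* N) :+ r :* (z :+ d :* N) :- q :* y :- r :* z
                            := (q :* c :+ r :* d) :* N) refl q r y z N c d)
  where open ℚSolver.+-*-Solver

-- Toggles on the ideals of a finite poset

∪⁅⁆-- : ∀ {n} {q : Fin n} {S} → q Subset.∉ S → (S ∪ ⁅ q ⁆) - q ≡ S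
∪⁅⁆-- {q = q} {S} q∉S = Subset.⊆-antisym to from
  where
  to : (S ∪ ⁅ q ⁆) - q Subset.⊆ S
  to {x} x∈ with Subset.x∈p∪q⁻ S ⁅ q ⁆ (Subset.p─q⊆p (S ∪ ⁅ q ⁆) ⁅ q ⁆ x∈)
  ... | inj₁ x∈S = x∈S
  ... | inj₂ x∈q = contradiction
    (subst (Subset._∈ (S ∪ ⁅ q ⁆) - q) (Subset.x∈⁅y⁆⇒x≡y q x∈q) x∈) (x∉p-x q (S ∪ ⁅ q ⁆))
  from : S Subset.⊆ (S ∪ ⁅ q ⁆) - q
  from x∈S = Subset.x∈p∧x≢y⇒x∈p-y (Subset.x∈p∪q⁺ (inj₁ x∈S)) λ { refl → q∉S x∈S }

-∪⁅⁆ : ∀ {n} {q : Fin n} {S} → q Subset.∈ S → (S - q) ∪ ⁅ q ⁆ ≡ S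
-∪⁅⁆ {q = q} {S} q∈S = Subset.⊆-antisym to from
  where
  to : (S - q) ∪ ⁅ q ⁆ Subset.⊆ S
  to x∈ with Subset.x∈p∪q⁻ (S - q) ⁅ q ⁆ x∈
  ... | inj₁ x∈S-q = Subset.p─q⊆p S ⁅ q ⁆ x∈S-q
  ... | inj₂ x∈q   = subst (Subset._∈ S) (sym (Subset.x∈⁅y⁆⇒x≡y q x∈q)) q∈S
  from : S Subset.⊆ (S - q) ∪ ⁅ q ⁆
  from {x} x∈S with x Fin.≟ q
  ... | yes x≡q = Subset.x∈p∪q⁺ (inj₂ (subst (Subset._∈ ⁅ q ⁆) (sym x≡q) (Subset.x∈⁅x⁆ q)))
  ... | no  x≢q = Subset.x∈p∪q⁺ (inj₁ (Subset.x∈p∧x≢y⇒x∈p-y x∈S x≢q))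

allPairs-++⁻ : ∀ {A : Set} {R : Rel A 0ℓ} xs {y zs} → AllPairs R (xs ++ y ∷ zs) →
               ListAll.All (λ x → R x y) xs × ListAll.All (R y) zs
allPairs-++⁻ []       (Ry ∷ _) = [] , Ry
allPairs-++⁻ (x ∷ xs) (Rx ∷ Rxs) with allPairs-++⁻ xs Rxs
... | before , after = ListAll.lookup Rx (∈-insert xs) ∷ before , after

allFin-split : ∀ {n} (q : Fin n) → ∃₂ λ ps ss →
               allFin n ≡ ps ++ q ∷ ss × ListAll.All (Fin._< q) ps × ListAll.All (q Fin.<_) ss
allFin-split q with ∈-∃++ (∈-allFin q)
... | ps , ss , eq with allPairs-++⁻ ps (subst (AllPairs Fin._<_) eq (AllPairs.tabulate⁺-< id))
...   | before , after = ps , ss , eq , before , after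

module Toggles {n : ℕ} {_≼_ : Rel (Fin n) 0ℓ} (≼-po : IsDecPartialOrder _≡_ _≼_) where
  open Ideals ≼-po

  _∈ᴵ_ : Fin n → Ideal → Set
  q ∈ᴵ I = q Subset.∈ elements I

  -- The closure field is irrelevant, so its result cannot be returned directly; decidability of
  -- membership makes it recomputable.
  ∈ᴵ-closed : ∀ I {x y} → x ≼ y → y ∈ᴵ I → x ∈ᴵ I
  ∈ᴵ-closed (mkIdeal S closed) x≼y y∈I = recompute (_ ∈? S) (closed _ _ x≼y y∈I)

  Ideal-≡ : ∀ {I J} → elements I ≡ elements J → I ≡ J
  Ideal-≡ refl = refl

  -- Records the branch taken by `τ` as facts about `elements`. With the result `J` as a free index,
  -- later case distinctions need not unfold `τ`.
  data Toggled (q : Fin n) (I J : Ideal) : Set where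
    added   : Minimal q (∁ (elements I)) → elements J ≡ elements I ∪ ⁅ q ⁆ → Toggled q I J
    removed : Maximal q (elements I) → elements J ≡ elements I - q → Toggled q I J
    fixed   : ¬ Minimal q (∁ (elements I)) → ¬ Maximal q (elements I) → J ≡ I → Toggled q I J

  toggled : ∀ q I → Toggled q I (τ q I)
  toggled q I with minimal? q (∁ (elements I)) | maximal? q (elements I)
  ... | yes min | _       = added min refl
  ... | no ¬min | yes max = removed max refl
  ... | no ¬min | no ¬max = fixed ¬min ¬max refl

  module _ {q : Fin n} {I J : Ideal} where
    added-maximal : Minimal q (∁ (elements I)) → elements J ≡ elements I ∪ ⁅ q ⁆ → Maximal q (elements J)
    added-maximal (q∈∁I , _) eq rewrite eq =
      Subset.x∈p∪q⁺ (inj₂ (Subset.x∈⁅x⁆ q)) , greatest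
      where
      greatest : ∀ r → r Subset.∈ elements I ∪ ⁅ q ⁆ → q ≼ r → r ≡ q
      greatest r r∈ q≼r with Subset.x∈p∪q⁻ (elements I) ⁅ q ⁆ r∈
      ... | inj₁ r∈I = contradiction (∈ᴵ-closed I q≼r r∈I) (Subset.x∈∁p⇒x∉p q∈∁I)
      ... | inj₂ r∈q = Subset.x∈⁅y⁆⇒x≡y q r∈q

    removed-minimal : Maximal q (elements I) → elements J ≡ elements I - q → Minimal q (∁ (elements J))
    removed-minimal (q∈I , _) eq rewrite eq =
      Subset.x∉p⇒x∈∁p (x∉p-x q (elements I)) , least
      where
      least : ∀ r → r Subset.∈ ∁ (elements I - q) → r ≼ q → r ≡ q
      least r r∈ r≼q with r Fin.≟ q
      ... | yes r≡q = r≡q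
      ... | no  r≢q = contradiction
        (Subset.x∈p∧x≢y⇒x∈p-y (∈ᴵ-closed I r≼q q∈I) r≢q) (Subset.x∈∁p⇒x∉p r∈)

  -- After an addition `q` is maximal in the ideal, and after a removal it is minimal in the
  -- complement, so the second toggle can only take the opposite branch.
  τ-involutive : ∀ q I → τ q (τ q I) ≡ I
  τ-involutive q I with toggled q I | toggled q (τ q I)
  ... | fixed _ _ eq     | _ = trans (cong (τ q) eq) eq
  ... | added min eq     | removed _ eq′ =
    Ideal-≡ (trans eq′ (trans (cong (_- q) eq) (∪⁅⁆-- (Subset.x∈∁p⇒x∉p (proj₁ min)))))
  ... | added min eq     | added min′ _ =
    contradiction (proj₁ (added-maximal {q} {I} {τ q I} min eq)) (Subset.x∈∁p⇒x∉p (proj₁ min′))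
  ... | added min eq     | fixed _ ¬max _ = contradiction (added-maximal {q} {I} {τ q I} min eq) ¬max
  ... | removed max eq   | added _ eq′ =
    Ideal-≡ (trans eq′ (trans (cong (_∪ ⁅ q ⁆) eq) (-∪⁅⁆ (proj₁ max))))
  ... | removed max eq   | removed max′ _ =
    contradiction (proj₁ max′) (Subset.x∈∁p⇒x∉p (proj₁ (removed-minimal {q} {I} {τ q I} max eq)))
  ... | removed max eq   | fixed ¬min _ _ = contradiction (removed-minimal {q} {I} {τ q I} max eq) ¬min

  bit : Ideal → Fin n → ℕ
  bit I q = if does (q ∈? elements I) then 1 else 0

  bit-∈ : ∀ I {q} → q ∈ᴵ I → bit I q ≡ 1
  bit-∈ I {q} q∈I with q ∈? elements I
  ... | yes _  = refl
  ... | no q∉I = contradiction q∈I q∉I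

  bit-∉ : ∀ I {q} → ¬ (q ∈ᴵ I) → bit I q ≡ 0
  bit-∉ I {q} q∉I with q ∈? elements I
  ... | yes q∈I = contradiction q∈I q∉I
  ... | no _    = refl

  bit-cong : ∀ {I J q} → (q ∈ᴵ I → q ∈ᴵ J) → (q ∈ᴵ J → q ∈ᴵ I) → bit I q ≡ bit J q
  bit-cong {I} {J} {q} to from = helper (q ∈? elements I)
    where
    helper : Dec (q ∈ᴵ I) → bit I q ≡ bit J q
    helper (yes q∈I) = trans (bit-∈ I q∈I) (sym (bit-∈ J (to q∈I)))
    helper (no  q∉I) = trans (bit-∉ I q∉I) (sym (bit-∉ J (q∉I ∘ from)))

  seq-χ̂ : ∀ q I k → seq (χ̂ q I) k ≡ seq (fromℕ (bit I q)) k
  seq-χ̂ q I k with q ∈? elements I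
  ... | yes _ = refl
  ... | no  _ = refl

  τ-other : ∀ {q r} → r ≢ q → ∀ I → bit (τ q I) r ≡ bit I r
  τ-other {q} {r} r≢q I with toggled q I
  ... | fixed _ _ eq = cong (λ J → bit J r) eq
  ... | added _ eq   = bit-cong {τ q I} {I} to from
    where
    to : r ∈ᴵ τ q I → r ∈ᴵ I
    to r∈ with Subset.x∈p∪q⁻ (elements I) ⁅ q ⁆ (subst (r Subset.∈_) eq r∈)
    ... | inj₁ r∈I = r∈I
    ... | inj₂ r∈q = contradiction (Subset.x∈⁅y⁆⇒x≡y q r∈q) r≢q
    from : r ∈ᴵ I → r ∈ᴵ τ q I
    from r∈I = subst (r Subset.∈_) (sym eq) (Subset.x∈p∪q⁺ (inj₁ r∈I))
  ... | removed _ eq = bit-cong {τ q I} {I}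
    (λ r∈ → Subset.p─q⊆p (elements I) ⁅ q ⁆ (subst (r Subset.∈_) eq r∈))
    (λ r∈I → subst (r Subset.∈_) (sym eq) (Subset.x∈p∧x≢y⇒x∈p-y r∈I r≢q))

  toggleAll : List (Fin n) → Ideal → Ideal
  toggleAll qs I = foldl (λ J q → τ q J) I qs

  toggleAll-foldl : ∀ qs (f : Ideal → Ideal) I → foldl (λ g q → τ q ∘ g) f qs I ≡ toggleAll qs (f I)
  toggleAll-foldl []       f I = refl
  toggleAll-foldl (q ∷ qs) f I = toggleAll-foldl qs (τ q ∘ f) I

  toggleAll-injective : ∀ qs → Injective _≡_ _≡_ (toggleAll qs)
  toggleAll-injective []       eq = eq
  toggleAll-injective (q ∷ qs) {I} {J} eq = trans (sym (τ-involutive q I))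
    (trans (cong (τ q) (toggleAll-injective qs eq)) (τ-involutive q J))

  toggleAll-other : ∀ {qs r} → ListAll.All (r ≢_) qs → ∀ I → bit (toggleAll qs I) r ≡ bit I r
  toggleAll-other []         I = refl
  toggleAll-other (r≢ ∷ r≢s) I = trans (toggleAll-other r≢s (τ _ I)) (τ-other r≢ I)

  -- Toggling all elements in increasing order passes through an ideal J that
  -- at the moment of toggling q agrees with the result below q and with I from q on.
  toggle-moment : ∀ I q → ∃ λ J →
    (∀ r → r Fin.< q → bit (toggleAll (allFin n) I) r ≡ bit J r) ×
    (bit (toggleAll (allFin n) I) q ≡ bit (τ q J) q) ×
    (∀ r → q Fin.≤ r → bit J r ≡ bit I r)
  toggle-moment I q with allFin-split q
  ... | ps , ss , eq , before , after = J
    , (λ r r<q → trans (unaffected r (ℕ.<⇒≤ r<q)) (τ-other (Fin.<⇒≢ r<q) J))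
    , unaffected q ℕ.≤-refl
    , (λ r q≤r → toggleAll-other (ListAll.map (λ p<q r≡p → Fin.<⇒≢ (ℕ.<-≤-trans p<q q≤r) (sym r≡p)) before) I)
    where
    J = toggleAll ps I
    unaffected : ∀ r → r Fin.≤ q → bit (toggleAll (allFin n) I) r ≡ bit (τ q J) r
    unaffected r r≤q = trans
      (cong (λ K → bit K r) (trans (cong (λ qs → toggleAll qs I) eq) (List.foldl-++ _ I ps (q ∷ ss))))
      (toggleAll-other (ListAll.map (λ q<s → Fin.<⇒≢ (ℕ.≤-<-trans r≤q q<s)) after) (τ q J))

-- Counting intervals; discrete harmonic sequences

-- Serves to turn the position of `s_(i,j)` in its chain, which is defined by counting, into
-- arithmetic on labels. The general `f` allows the induction to pass to `f ∘ Fin.suc`.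
length-filter-tabulate : ∀ {X : Set} {P : Pred X 0ℓ} (P? : Decidable P) m (f : Fin m → X) lo hi →
  hi ≤ m → (∀ x → P (f x) ⇔ (lo ≤ toℕ x × toℕ x < hi)) →
  length (filter P? (tabulate f)) ≡ hi ∸ lo
length-filter-tabulate P? zero    f lo .zero z≤n P⇔ = sym (ℕ.0∸n≡0 lo)
length-filter-tabulate P? (suc m) f lo hi hi≤m P⇔ with P? (f Fin.zero)
length-filter-tabulate P? (suc m) f lo zero hi≤m P⇔ | yes p =
  contradiction (proj₂ (Equivalence.to (P⇔ Fin.zero) p)) λ ()
length-filter-tabulate P? (suc m) f (suc lo) (suc hi) hi≤m P⇔ | yes p =
  contradiction (proj₁ (Equivalence.to (P⇔ Fin.zero) p)) λ ()
length-filter-tabulate P? (suc m) f zero (suc hi) (s≤s hi≤m) P⇔ | yes p =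
  cong suc (length-filter-tabulate P? m (f ∘ Fin.suc) zero hi hi≤m λ x → mk⇔
    (λ px → z≤n , ℕ.≤-pred (proj₂ (Equivalence.to (P⇔ (Fin.suc x)) px)))
    (λ (_ , x<hi) → Equivalence.from (P⇔ (Fin.suc x)) (z≤n , s≤s x<hi)))
length-filter-tabulate P? (suc m) f zero (suc hi) (s≤s hi≤m) P⇔ | no ¬p =
  contradiction (Equivalence.from (P⇔ Fin.zero) (z≤n , s≤s z≤n)) ¬p
length-filter-tabulate P? (suc m) f lo zero hi≤m P⇔ | no ¬p =
  length-filter-tabulate P? m (f ∘ Fin.suc) lo zero z≤n λ x → mk⇔
    (λ px → contradiction (proj₂ (Equivalence.to (P⇔ (Fin.suc x)) px)) λ ())
    (λ (_ , x<0) → contradiction x<0 λ ())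
length-filter-tabulate P? (suc m) f (suc lo) (suc hi) (s≤s hi≤m) P⇔ | no ¬p =
  length-filter-tabulate P? m (f ∘ Fin.suc) lo hi hi≤m λ x → mk⇔
    (λ px → let l , h = Equivalence.to (P⇔ (Fin.suc x)) px in ℕ.≤-pred l , ℕ.≤-pred h)
    (λ (l , h) → Equivalence.from (P⇔ (Fin.suc x)) (s≤s l , s≤s h))

module _ (S : ℕ → ℕ) (m : ℕ)
         (harmonic : ∀ d → suc (suc d) ≤ m → S (suc d) + S (suc d) ≡ S d + S (suc (suc d))) where
  open ℕSolver.+-*-Solver
  open ≡-Reasoning

  -- The additive form of `S d = S 0 + d (S 1 - S 0)`, which avoids truncated subtraction.
  progression : ∀ d → d ≤ m → S d + d * S 0 ≡ S 0 + d * S 1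
  progression zero          _ = refl
  progression (suc zero)    _ = solve 2 (λ x y → y :+ (x :+ con 0) := x :+ (y :+ con 0)) refl (S 0) (S 1)
  -- Adding the case `d` to both sides brings `S d` next to `S (2 + d)`, so that `harmonic` merges
  -- them into twice `S (1 + d)` and the case `1 + d` can be applied doubled.
  progression (suc (suc d)) d+2≤m = ℕ.+-cancelʳ-≡ (S 0 + d * S 1) _ _ (begin
    S (2 + d) + (2 + d) * S 0 + (S 0 + d * S 1)
      ≡⟨ cong (S (2 + d) + (2 + d) * S 0 +_) (progression d (ℕ.≤-trans (ℕ.m≤n+m d 2) d+2≤m)) ⟨
    S (2 + d) + (2 + d) * S 0 + (S d + d * S 0)
      ≡⟨ solve 4 (λ y x z d → y :+ (con 2 :+ d) :* z :+ (x :+ d :* z)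
                            := (x :+ y) :+ (con 2 :* (con 1 :+ d)) :* z) refl
           (S (2 + d)) (S d) (S 0) d ⟩
    (S d + S (2 + d)) + 2 * (1 + d) * S 0
      ≡⟨ cong (_+ 2 * (1 + d) * S 0) (harmonic d d+2≤m) ⟨
    (S (1 + d) + S (1 + d)) + 2 * (1 + d) * S 0
      ≡⟨ solve 3 (λ y z d → (y :+ y) :+ con 2 :* (con 1 :+ d) :* z := con 2 :* (y :+ (con 1 :+ d) :* z)) refl
           (S (1 + d)) (S 0) d ⟩
    2 * (S (1 + d) + (1 + d) * S 0)
      ≡⟨ cong (2 *_) (progression (suc d) (ℕ.<⇒≤ d+2≤m)) ⟩
    2 * (S 0 + (1 + d) * S 1)
      ≡⟨ solve 3 (λ z w d → con 2 :* (z :+ (con 1 :+ d) :* w) := z :+ (con 2 :+ d) :* w :+ (z :+ d :* w)) refl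
           (S 0) (S 1) d ⟩
    S 0 + (2 + d) * S 1 + (S 0 + d * S 1) ∎)

  -- Eliminates `S 1` between the cases `d` and `m` of `progression`; the cancelled term is `d`
  -- times the right-hand side of the case `m`.
  interpolate : ∀ d e → d + e ≡ m → m * S d ≡ d * S m + e * S 0
  interpolate d e refl = ℕ.+-cancelʳ-≡ (d * (S 0 + (d + e) * S 1)) _ _ (begin
    (d + e) * S d + d * (S 0 + (d + e) * S 1)
      ≡⟨ cong (λ s → (d + e) * S d + d * s) (progression (d + e) ℕ.≤-refl) ⟨
    (d + e) * S d + d * (S (d + e) + (d + e) * S 0)
      ≡⟨ solve 5 (λ d e x y z → (d :+ e) :* x :+ d :* (y :+ (d :+ e) :* z)
                              := d :* y :+ (d :+ e) :* (x :+ d :* z)) refl d e (S d) (S (d + e)) (S 0) ⟩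
    d * S (d + e) + (d + e) * (S d + d * S 0)
      ≡⟨ cong (λ s → d * S (d + e) + (d + e) * s) (progression d (ℕ.m≤m+n d e)) ⟩
    d * S (d + e) + (d + e) * (S 0 + d * S 1)
      ≡⟨ solve 5 (λ d e y z w → d :* y :+ (d :+ e) :* (z :+ d :* w)
                              := d :* y :+ e :* z :+ d :* (z :+ (d :+ e) :* w)) refl d e (S (d + e)) (S 0) (S 1) ⟩
    d * S (d + e) + e * S 0 + d * (S 0 + (d + e) * S 1) ∎)

partialSum-suc : ∀ {t} (α : Vec ℕ t) i →
  partialSum (Vec.toList α) (suc (toℕ i)) ≡ partialSum (Vec.toList α) (toℕ i) + lookup α i
partialSum-suc (x ∷ α) Fin.zero    = ℕ.+-identityʳ x
partialSum-suc (x ∷ α) (Fin.suc i) = trans (cong (x +_) (partialSum-suc α i))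
  (sym (ℕ.+-assoc x (partialSum (Vec.toList α) (toℕ i)) (lookup α i)))

parity-suc : ∀ k → ℕ.parity (suc k) ≡ ℕ.parity k ⁻¹
parity-suc k = trans (sym (ℙ.⁻¹-involutive (ℕ.parity (suc k)))) (cong _⁻¹ (ℙ.suc-homo-⁻¹ k))

n<m∸1⇒1+n<m : ∀ {k} m → k < m ∸ 1 → suc k < m
n<m∸1⇒1+n<m (suc m) k<m = s≤s k<m

1+n<m⇒n<m∸1 : ∀ {k} m → suc k < m → k < m ∸ 1
1+n<m⇒n<m∸1 (suc m) (s≤s k<m) = k<m

-- Promotion on a fence

module Promotion {t : ℕ} (α : Vec ℕ t) (α≥1 : All (1 ≤_) α) where
  open Fence α renaming (_≤_ to _≼_; _≤?_ to _≼?_)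
  open Toggles {n} {_≼_} ≤-isDecPartialOrder

  a-suc : ∀ i → a (idx i) ≡ a (toℕ i) + lookup α i
  a-suc = partialSum-suc α

  a-mono : ∀ {k l} → k ≤ l → a k ≤ a l
  a-mono = partialSum-mono (Vec.toList α)

  a-mono-< : ∀ {k l} → k < l → l ≤ t → a k < a l
  a-mono-< {k} {l} k<l l≤t = ℕ.<-≤-trans (subst (λ k → a k < a (suc k)) (Fin.toℕ-fromℕ< k<t) a<) (a-mono k<l)
    where
    k<t = ℕ.<-≤-trans k<l l≤t
    i = fromℕ< k<t
    a< : a (toℕ i) < a (suc (toℕ i))
    a< = subst (a (toℕ i) <_) (sym (a-suc i)) (ℕ.m<m+n (a (toℕ i)) (Vec.lookup⁺ α≥1 i))

  label<a : ∀ q → label q < a t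
  label<a q = n<m∸1⇒1+n<m (a t) (Fin.toℕ<n {n} q)

  labelled : ∀ {k} → 1 ≤ k → k < a t → ∃ λ (q : Fin n) → label q ≡ k
  labelled {suc k} _ k<a = fromℕ< k<n , cong suc (Fin.toℕ-fromℕ< k<n)
    where k<n = 1+n<m⇒n<m∸1 (a t) k<a

  label-injective : ∀ {q r : Fin n} → label q ≡ label r → q ≡ r
  label-injective = Fin.toℕ-injective ∘ ℕ.suc-injective

  a≡⇒≡t : ∀ i → a t ≤ a (idx i) → idx i ≡ t
  a≡⇒≡t i at≤ with ℕ.m≤n⇒m<n∨m≡n (Fin.toℕ<n i)
  ... | inj₁ i<t = contradiction at≤ (ℕ.<⇒≱ (a-mono-< i<t ℕ.≤-refl))
  ... | inj₂ i≡t = i≡t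

  a<1⇒≡0 : ∀ (i : Fin t) → a (toℕ i) < 1 → toℕ i ≡ 0
  a<1⇒≡0 Fin.zero      _ = refl
  a<1⇒≡0 i@(Fin.suc _) a<1 = contradiction (a-mono-< {0} (s≤s z≤n) (ℕ.<⇒≤ (Fin.toℕ<n i))) (ℕ.≤⇒≯ (ℕ.≤-pred a<1))

  -- Labels 0 and n + 1 stand for virtual ends, which are always in the ideal at
  -- the bottom of a segment and never at the top of one.
  boundary : ℕ → ℕ
  boundary zero    = 1
  boundary (suc _) with ℕ.parity t
  ... | 0ℙ = 1
  ... | 1ℙ = 0

  boundary-even : ∀ k → ℕ.parity t ≡ 0ℙ → boundary k ≡ 1
  boundary-even zero    _  = refl
  boundary-even (suc _) eq rewrite eq = refl

  boundary-odd : ∀ k → ℕ.parity t ≡ 1ℙ → boundary (suc k) ≡ 0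
  boundary-odd _ eq rewrite eq = refl

  labelled? : ∀ k → Dec (∃ λ (q : Fin n) → label q ≡ k)
  labelled? k = Fin.any? λ q → label q ℕ.≟ k

  value : ∀ {k} → Dec (∃ λ (q : Fin n) → label q ≡ k) → Ideal → ℕ
  value     (yes (q , _)) I = bit I q
  value {k} (no _)        I = boundary k

  -- With the indicator continued past both ends, every unshared element has two neighbouring
  -- values, and the first and last segments obey the same recurrence as the others.
  extended : Ideal → ℕ → ℕ
  extended I k = value (labelled? k) I

  extended-label : ∀ I {k} q → label q ≡ k → extended I k ≡ bit I q
  extended-label I {k} q eq = helper (labelled? k)
    where
    helper : ∀ d → value d I ≡ bit I q
    helper (yes (r , eq′)) = cong (bit I) (label-injective (trans eq′ (sym eq)))
    helper (no ∄)          = contradiction (q , eq) ∄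

  extended-boundary : ∀ I {k} → (∀ (q : Fin n) → label q ≢ k) → extended I k ≡ boundary k
  extended-boundary I {k} ∄ = helper (labelled? k)
    where
    helper : ∀ d → value d I ≡ boundary k
    helper (yes (r , eq)) = contradiction eq (∄ r)
    helper (no _)         = refl

  extended-cong : ∀ I J k → (∀ q → label q ≡ k → bit I q ≡ bit J q) → extended I k ≡ extended J k
  extended-cong I J k agree = helper (labelled? k)
    where
    helper : ∀ d → value d I ≡ value d J
    helper (yes (q , eq)) = agree q eq
    helper (no _)         = refl

  -- `Star` exposes the first cover of a chain, whereas minimality of `q` is decided by the last
  -- one, just below `q`.
  ≼-last : ∀ {r q} → r ≼ q → r ≡ q ⊎ ∃ λ s → r ≼ s × s ⋖ q
  ≼-last Star.ε = inj₁ refl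
  ≼-last (r⋖s ◅ s≼q) with ≼-last s≼q
  ... | inj₁ refl             = inj₂ (_ , Star.ε , r⋖s)
  ... | inj₂ (u , s≼u , u⋖q) = inj₂ (u , r⋖s ◅ s≼u , u⋖q)

  ⋖-minimal : ∀ J {q} → ¬ (q ∈ᴵ J) → (∀ r → r ⋖ q → r ∈ᴵ J) → Minimal q (∁ (elements J))
  ⋖-minimal J {q} q∉J below = Subset.x∉p⇒x∈∁p q∉J , least
    where
    least : ∀ r → r Subset.∈ ∁ (elements J) → r ≼ q → r ≡ q
    least r r∉ r≼q with ≼-last r≼q
    ... | inj₁ r≡q            = r≡q
    ... | inj₂ (s , r≼s , s⋖q) = contradiction (∈ᴵ-closed J r≼s (below s s⋖q)) (Subset.x∈∁p⇒x∉p r∉)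

  ⋖-maximal : ∀ J {q} → q ∈ᴵ J → (∀ r → q ⋖ r → ¬ (r ∈ᴵ J)) → Maximal q (elements J)
  ⋖-maximal J {q} q∈J above = q∈J , greatest
    where
    greatest : ∀ r → r ∈ᴵ J → q ≼ r → r ≡ q
    greatest r r∈J Star.ε           = refl
    greatest r r∈J (q⋖s ◅ s≼r) = contradiction (∈ᴵ-closed J s≼r r∈J) (above _ q⋖s)

  -- The label `k` may be occupied or virtual. The first component covers both cases: only an
  -- element at `k` can be adjacent to `q` on this side. The second ensures that a virtual neighbour
  -- never obstructs toggling `q`.
  LowerNeighbour UpperNeighbour : Fin n → ℕ → Set
  LowerNeighbour q k = (∀ r → r ⋖ q ⇔ label r ≡ k) × ((∀ (r : Fin n) → label r ≢ k) → boundary k ≡ 1)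
  UpperNeighbour q k = (∀ r → q ⋖ r ⇔ label r ≡ k) × ((∀ (r : Fin n) → label r ≢ k) → boundary k ≡ 0)

  private
    lower-cases : ∀ J {q k} → LowerNeighbour q k →
      (extended J k ≡ 1 × (∀ r → r ⋖ q → r ∈ᴵ J)) ⊎
      (extended J k ≡ 0 × ∃ λ r → r ⋖ q × ¬ (r ∈ᴵ J))
    lower-cases J {q} {k} (nb , bd) with labelled? k
    ... | no ∄ = inj₁ (bd (λ r eq → ∄ (r , eq)) , λ r r⋖q → contradiction (r , Equivalence.to (nb r) r⋖q) ∄)
    ... | yes (r , eq) with r Subset.∈? elements J
    ...   | yes r∈J = inj₁ (refl , λ s s⋖q →
              subst (_∈ᴵ J) (label-injective (trans eq (sym (Equivalence.to (nb s) s⋖q)))) r∈J)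
    ...   | no  r∉J = inj₂ (refl , r , Equivalence.from (nb r) eq , r∉J)

    upper-cases : ∀ J {q k} → UpperNeighbour q k →
      (extended J k ≡ 0 × (∀ r → q ⋖ r → ¬ (r ∈ᴵ J))) ⊎
      (extended J k ≡ 1 × ∃ λ r → q ⋖ r × r ∈ᴵ J)
    upper-cases J {q} {k} (nb , bd) with labelled? k
    ... | no ∄ = inj₁ (bd (λ r eq → ∄ (r , eq)) , λ r q⋖r → contradiction (r , Equivalence.to (nb r) q⋖r) ∄)
    ... | yes (r , eq) with r Subset.∈? elements J
    ...   | yes r∈J = inj₂ (refl , r , Equivalence.from (nb r) eq , r∈J)
    ...   | no  r∉J = inj₁ (refl , λ s q⋖s s∈J → r∉J
              (subst (_∈ᴵ J) (label-injective (trans (Equivalence.to (nb s) q⋖s) (sym eq))) s∈J))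

  ⋖⇒≼ : ∀ {q r} → q ⋖ r → q ≼ r
  ⋖⇒≼ q⋖r = q⋖r ◅ Star.ε

  ⋖⇒≢ : ∀ {q r} → q ⋖ r → q ≢ r
  ⋖⇒≢ (inj₁ (eq , _)) refl = ℕ.1+n≢n (sym eq)
  ⋖⇒≢ (inj₂ (eq , _)) refl = ℕ.1+n≢n (sym eq)

  -- Closure excludes an absent lower with a present upper neighbour. If both are absent, `q` is
  -- absent and blocked; if both are present, `q` is present and cannot leave; only a present lower
  -- and absent upper neighbour leave `q` free, and then the toggle flips it. The old and new values
  -- add up to 0, 2 and 1 respectively.
  toggled-step : ∀ {J K q l u} → Toggled q J K → LowerNeighbour q l → UpperNeighbour q u →
                 bit K q + bit J q ≡ extended J l + extended J u
  toggled-step {J} {K} {q} tog lower upper with lower-cases J lower | upper-cases J upper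
  ... | inj₂ (l≡0 , r , r⋖q , r∉J) | inj₂ (u≡1 , s , q⋖s , s∈J) =
    contradiction (∈ᴵ-closed J (r⋖q ◅ q⋖s ◅ Star.ε) s∈J) r∉J
  ... | inj₂ (l≡0 , r , r⋖q , r∉J) | inj₁ (u≡0 , _) = trans (absent tog) (sym (cong₂ _+_ l≡0 u≡0))
    where
    absent : Toggled q J K → bit K q + bit J q ≡ 0
    absent (added (_ , least) _)   = contradiction (least r (Subset.x∉p⇒x∈∁p r∉J) (⋖⇒≼ r⋖q)) (⋖⇒≢ r⋖q)
    absent (removed (q∈J , _) _)   = contradiction (∈ᴵ-closed J (⋖⇒≼ r⋖q) q∈J) r∉J
    absent (fixed _ _ eq) = trans (cong (λ K → bit K q + bit J q) eq) (cong₂ _+_ q∉ q∉)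
      where q∉ = bit-∉ J (λ q∈J → r∉J (∈ᴵ-closed J (⋖⇒≼ r⋖q) q∈J))
  ... | inj₁ (l≡1 , below) | inj₂ (u≡1 , s , q⋖s , s∈J) = trans (present tog) (sym (cong₂ _+_ l≡1 u≡1))
    where
    present : Toggled q J K → bit K q + bit J q ≡ 2
    present (added (q∈∁ , _) _)        = contradiction (∈ᴵ-closed J (⋖⇒≼ q⋖s) s∈J) (Subset.x∈∁p⇒x∉p q∈∁)
    present (removed (_ , greatest) _) = contradiction (sym (greatest s s∈J (⋖⇒≼ q⋖s))) (⋖⇒≢ q⋖s)
    present (fixed _ _ eq) = trans (cong (λ K → bit K q + bit J q) eq) (cong₂ _+_ q∈ q∈)
      where q∈ = bit-∈ J (∈ᴵ-closed J (⋖⇒≼ q⋖s) s∈J)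
  ... | inj₁ (l≡1 , below) | inj₁ (u≡0 , above) = trans (flips tog) (sym (cong₂ _+_ l≡1 u≡0))
    where
    neither : ¬ Minimal q (∁ (elements J)) → ¬ Maximal q (elements J) → Dec (q ∈ᴵ J) → bit K q + bit J q ≡ 1
    neither ¬min ¬max (yes q∈J) = contradiction (⋖-maximal J q∈J above) ¬max
    neither ¬min ¬max (no  q∉J) = contradiction (⋖-minimal J q∉J below) ¬min
    flips : Toggled q J K → bit K q + bit J q ≡ 1
    flips (added min eq)   = cong₂ _+_ (bit-∈ K (proj₁ (added-maximal {q} {J} {K} min eq)))
      (bit-∉ J (Subset.x∈∁p⇒x∉p (proj₁ min)))
    flips (removed max eq) = cong₂ _+_ (bit-∉ K (Subset.x∈∁p⇒x∉p (proj₁ (removed-minimal {q} {J} {K} max eq))))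
      (bit-∈ J (proj₁ max))
    flips (fixed ¬min ¬max _) = neither ¬min ¬max (q Subset.∈? elements J)

  Pro≡toggleAll : ∀ I → Pro I ≡ toggleAll (allFin n) I
  Pro≡toggleAll = toggleAll-foldl (allFin n) id

  Interior : Fin t → ℕ → Set
  Interior i k = a (toℕ i) < k × k < a (idx i)

  idx≤t : ∀ i → idx i ≤ t
  idx≤t = Fin.toℕ<n

  a-idx≤a-t : ∀ i → a (idx i) ≤ a t
  a-idx≤a-t i = a-mono (idx≤t i)

  interior-labelled : ∀ {i k} → Interior i k → ∃ λ (q : Fin n) → label q ≡ k
  interior-labelled {i} (lo , hi) = labelled (ℕ.≤-<-trans z≤n lo) (ℕ.<-≤-trans hi (a-idx≤a-t i))

  module _ {q : Fin n} {i : Fin t} (interior : Interior i (label q)) where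
    private
      lo = proj₁ interior
      hi = proj₂ interior

      left-of : ∀ {r : Fin n} → label q ≡ suc (label r) → a (toℕ i) ≤ label r × label r < a (idx i)
      left-of eq = ℕ.≤-pred (subst (a (toℕ i) <_) eq lo)
                 , ℕ.<-trans (ℕ.≤-reflexive (sym eq)) hi

      no-left : (∀ (r : Fin n) → label r ≢ toℕ q) → toℕ q ≡ 0
      no-left ∄ with toℕ q in eq
      ... | zero  = refl
      ... | suc k with r , eq′ ← labelled {suc k} (s≤s z≤n)
                        (ℕ.<-trans (ℕ.n<1+n _) (subst (λ k → suc k < a t) eq (label<a q))) = contradiction eq′ (∄ r)

      no-right : (∀ (r : Fin n) → label r ≢ 2 + toℕ q) → idx i ≡ t
      no-right ∄ with ℕ.<-≤-connex (2 + toℕ q) (a t)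
      ... | inj₁ lt with r , eq ← labelled (s≤s z≤n) lt = contradiction eq (∄ r)
      ... | inj₂ ge = a≡⇒≡t i (ℕ.≤-trans ge hi)

    module _ (odd : ℕ.parity (idx i) ≡ 1ℙ) where
      -- In this and the next three lemmas the adjacent labels are `toℕ q` and `2 + toℕ q`, because
      -- `label q` is `suc (toℕ q)`. An unoccupied left label is 0; an unoccupied right label makes
      -- `i` the last segment, so that the direction of `i` is given by the parity of `t` and fixes
      -- the boundary value.
      rising-lower : LowerNeighbour q (toℕ q)
      rising-lower = (λ r → mk⇔
        (λ { (inj₁ (eq , _)) → sym (ℕ.suc-injective eq)
           ; (inj₂ (_ , falls)) → contradiction falls (disjoint (i , odd , ℕ.<⇒≤ lo , hi)) })
        (λ eq → inj₁ (cong suc (sym eq) , i , odd , left-of (cong suc (sym eq)))))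
        , λ ∄ → cong boundary (no-left ∄)

      rising-upper : UpperNeighbour q (2 + toℕ q)
      rising-upper = (λ r → mk⇔
        (λ { (inj₁ (eq , _)) → eq
           ; (inj₂ (eq , falls)) → contradiction falls (disjoint (i , odd , left-of eq)) })
        (λ eq → inj₁ (eq , i , odd , ℕ.<⇒≤ lo , hi)))
        , λ ∄ → boundary-odd (suc (toℕ q)) (subst (λ k → ℕ.parity k ≡ 1ℙ) (no-right ∄) odd)

    module _ (even : ℕ.parity (idx i) ≡ 0ℙ) where
      falling-lower : LowerNeighbour q (2 + toℕ q)
      falling-lower = (λ r → mk⇔
        (λ { (inj₁ (eq , rises)) → contradiction (i , even , left-of eq) (disjoint rises)
           ; (inj₂ (eq , _)) → eq })
        (λ eq → inj₂ (eq , i , even , ℕ.<⇒≤ lo , hi)))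
        , λ ∄ → boundary-even (2 + toℕ q) (subst (λ k → ℕ.parity k ≡ 0ℙ) (no-right ∄) even)

      falling-upper : UpperNeighbour q (toℕ q)
      falling-upper = (λ r → mk⇔
        (λ { (inj₁ (_ , rises)) → contradiction (i , even , ℕ.<⇒≤ lo , hi) (disjoint rises)
           ; (inj₂ (eq , _)) → sym (ℕ.suc-injective eq) })
        (λ eq → inj₂ (cong suc (sym eq) , i , even , left-of (cong suc (sym eq)))))
        -- A virtual upper neighbour on the left would make the falling segment the first one, but
        -- that one rises.
        , λ ∄ → contradiction
            (trans (sym even) (cong (ℕ.parity ∘ suc) (a<1⇒≡0 i (subst (λ k → a (toℕ i) < suc k) (no-left ∄) lo))))
            λ ()

    toggle-interior : ∀ J → bit (τ q J) q + bit J q ≡ extended J (toℕ q) + extended J (2 + toℕ q)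
    toggle-interior J = helper (ℕ.parity (idx i)) refl
      where
      helper : ∀ p → ℕ.parity (idx i) ≡ p →
               bit (τ q J) q + bit J q ≡ extended J (toℕ q) + extended J (2 + toℕ q)
      helper 1ℙ eq = toggled-step (toggled q J) (rising-lower eq) (rising-upper eq)
      helper 0ℙ eq = trans (toggled-step (toggled q J) (falling-lower eq) (falling-upper eq))
                       (ℕ.+-comm (extended J (2 + toℕ q)) (extended J (toℕ q)))

    promote-interior : ∀ I →
      bit (Pro I) q + bit I q ≡ extended (Pro I) (toℕ q) + extended I (2 + toℕ q)
    promote-interior I = trans (cong (λ K → bit K q + bit I q) Pro≡)
      (trans toggleAll-interior (cong (λ K → extended K (toℕ q) + extended I (2 + toℕ q)) (sym Pro≡)))
      where
      Pro≡ = Pro≡toggleAll I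
      moment = toggle-moment I q
      J = proj₁ moment
      below = proj₁ (proj₂ moment)
      at = proj₁ (proj₂ (proj₂ moment))
      above = proj₂ (proj₂ (proj₂ moment))
      open ≡-Reasoning
      toggleAll-interior :
        bit (toggleAll (allFin n) I) q + bit I q ≡
        extended (toggleAll (allFin n) I) (toℕ q) + extended I (2 + toℕ q)
      toggleAll-interior = begin
        bit (toggleAll (allFin n) I) q + bit I q     ≡⟨ cong₂ _+_ at (sym (above q ℕ.≤-refl)) ⟩
        bit (τ q J) q + bit J q                      ≡⟨ toggle-interior J ⟩
        extended J (toℕ q) + extended J (2 + toℕ q)  ≡⟨ cong₂ _+_
          (extended-cong J _ (toℕ q) λ r eq → sym (below r (subst (suc (toℕ r) ≤_) eq ℕ.≤-refl)))
          (extended-cong J I (2 + toℕ q) λ r eq → above r (subst (toℕ q ≤_) (sym (ℕ.suc-injective eq)) (ℕ.n≤1+n _))) ⟩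
        extended (toggleAll (allFin n) I) (toℕ q) + extended I (2 + toℕ q) ∎

  Pro-injective : Injective _≡_ _≡_ Pro
  Pro-injective {I} {J} eq = toggleAll-injective (allFin n)
    (trans (sym (Pro≡toggleAll I)) (trans eq (Pro≡toggleAll J)))

  total : List⁺ Ideal → ℕ → ℕ
  total O k = sum (map (λ I → extended I k) (List⁺.toList O))

  module _ (O : List⁺ Ideal) (orbit : IsOrbit Pro O) where

    total-Pro : ∀ k → sum (map (λ I → extended (Pro I) k) (List⁺.toList O)) ≡ total O k
    total-Pro k = orbit-sum {T = Pro} Pro-injective (λ I → extended I k) O orbit

    total-harmonic : ∀ {i} k → Interior i (suc k) → total O (suc k) + total O (suc k) ≡ total O k + total O (2 + k)
    total-harmonic k interior with interior-labelled interior
    ... | q , refl = begin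
      total O (label q) + total O (label q)
        ≡⟨ cong (_+ total O (label q)) (total-Pro (label q)) ⟨
      sum (map (λ I → extended (Pro I) (label q)) xs) + total O (label q)
        ≡⟨ sum-map-+ (λ I → extended (Pro I) (label q)) (λ I → extended I (label q)) xs ⟨
      sum (map (λ I → extended (Pro I) (label q) + extended I (label q)) xs)
        ≡⟨ cong sum (List.map-cong (λ I → trans
             (cong₂ _+_ (extended-label (Pro I) q refl) (extended-label I q refl))
             (promote-interior interior I)) xs) ⟩
      sum (map (λ I → extended (Pro I) (toℕ q) + extended I (2 + toℕ q)) xs)
        ≡⟨ sum-map-+ (λ I → extended (Pro I) (toℕ q)) (λ I → extended I (2 + toℕ q)) xs ⟩
      sum (map (λ I → extended (Pro I) (toℕ q)) xs) + total O (2 + toℕ q)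
        ≡⟨ cong (_+ total O (2 + toℕ q)) (total-Pro (toℕ q)) ⟩
      total O (toℕ q) + total O (2 + toℕ q) ∎
      where
      open ≡-Reasoning
      xs = List⁺.toList O

    -- Every label strictly between the ends of the segment is interior, so `interpolate` applies to
    -- the whole segment. In the first and last segments the outer ends `a 0` and `a t` are
    -- precisely the virtual labels 0 and `n + 1`.
    total-interpolate : ∀ i d e → d + e ≡ lookup α i →
      lookup α i * total O (a (toℕ i) + d) ≡ d * total O (a (idx i)) + e * total O (a (toℕ i))
    total-interpolate i d e d+e≡α = subst₂
      (λ k l → lookup α i * total O (a (toℕ i) + d) ≡ d * total O k + e * total O l)
      (sym (a-suc i)) (ℕ.+-identityʳ (a (toℕ i)))
      (interpolate (λ d → total O (a (toℕ i) + d)) (lookup α i) harmonic d e d+e≡α)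
      where
      harmonic : ∀ d → 2 + d ≤ lookup α i →
        total O (a (toℕ i) + suc d) + total O (a (toℕ i) + suc d) ≡
        total O (a (toℕ i) + d) + total O (a (toℕ i) + (2 + d))
      harmonic d d+2≤α = trans (cong₂ _+_ (cong (total O) k+1) (cong (total O) k+1))
        (trans (total-harmonic {i} (a (toℕ i) + d)
            ( s≤s (ℕ.m≤m+n (a (toℕ i)) d)
            , subst₂ _≤_ k+2 (sym (a-suc i)) (ℕ.+-monoʳ-≤ (a (toℕ i)) d+2≤α)))
          (cong (λ k → total O (a (toℕ i) + d) + total O k) (sym k+2)))
        where
        k+1 : a (toℕ i) + suc d ≡ suc (a (toℕ i) + d)
        k+1 = ℕ.+-suc (a (toℕ i)) d
        k+2 : a (toℕ i) + (2 + d) ≡ 2 + (a (toℕ i) + d)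
        k+2 = trans (ℕ.+-suc (a (toℕ i)) (suc d)) (cong suc k+1)

-- Positions in segments and the generating statistics

module Generators {t : ℕ} (α : Vec ℕ t) (α≥1 : All (1 ≤_) α) where
  open Fence α renaming (_≤_ to _≼_; _≤?_ to _≼?_)
  open Toggles {n} {_≼_} ≤-isDecPartialOrder
  open Promotion α α≥1

  -- Unfolds to `Peak` at `1ℙ` and to `Valley` at `0ℙ`, so one argument about the ends of a segment
  -- handles both.
  SharedOf : Parity → Fin n → Set
  SharedOf p q = ∃ λ k → SharedAt q k × ℕ.parity (toℕ k) ≡ p

  shared-index : ∀ i {q k} → SharedAt q k → q ∈Seg i → toℕ k ≡ toℕ i ⊎ toℕ k ≡ idx i
  shared-index i {q} {k} (_ , eq) (lo , hi) with ℕ.<-cmp (toℕ k) (toℕ i) | ℕ.<-cmp (toℕ k) (idx i)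
  ... | tri≈ _ k≡i _ | _            = inj₁ k≡i
  ... | _            | tri≈ _ k≡i _ = inj₂ k≡i
  ... | tri< k<i _ _ | _            =
    contradiction (subst (a (toℕ i) ≤_) eq lo) (ℕ.<⇒≱ (a-mono-< k<i (ℕ.<⇒≤ (Fin.toℕ<n i))))
  ... | _            | tri> _ _ i<k =
    contradiction (subst (_≤ a (idx i)) eq hi) (ℕ.<⇒≱ (a-mono-< i<k (ℕ.<⇒≤ (Fin.toℕ<n k))))
  ... | tri> _ _ i<k | tri< k<i _ _ = contradiction k<i (ℕ.≤⇒≯ i<k)

  -- The two ends of a segment have indices of opposite parity, so the parity singles out one of
  -- them. In the first segment both sides are impossible, as labels start at 1 while `a 0` is 0.
  shared-start : ∀ i q → (SharedOf (ℕ.parity (toℕ i)) q × q ∈Seg i) ⇔ (label q ≡ a (toℕ i))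
  shared-start i q = mk⇔ to λ eq →
    (i , (0<i eq , eq) , refl) , ℕ.≤-reflexive (sym eq) , ℕ.≤-trans (ℕ.≤-reflexive eq) (a-mono (ℕ.n≤1+n (toℕ i)))
    where
    to : SharedOf (ℕ.parity (toℕ i)) q × q ∈Seg i → label q ≡ a (toℕ i)
    to ((k , sh , par) , seg) with shared-index i sh seg
    ... | inj₁ k≡i = trans (proj₂ sh) (cong a k≡i)
    ... | inj₂ k≡  = contradiction
      (trans (sym par) (trans (cong ℕ.parity k≡) (parity-suc (toℕ i)))) (ℙ.p≢p⁻¹ (ℕ.parity (toℕ i)))
    0<i : label q ≡ a (toℕ i) → 1 ≤ toℕ i
    0<i eq = ℕ.n≢0⇒n>0 λ i≡0 → ℕ.1+n≢0 (trans eq (cong a i≡0))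

  shared-end : ∀ i q → (SharedOf (ℕ.parity (idx i)) q × q ∈Seg i) ⇔ (label q ≡ a (idx i))
  shared-end i q = mk⇔ to λ eq →
    ( fromℕ< (i<t eq)
    , (subst (1 ≤_) (sym (toℕ≡ eq)) (s≤s z≤n) , trans eq (cong a (sym (toℕ≡ eq))))
    , cong ℕ.parity (toℕ≡ eq))
    , ℕ.≤-trans (a-mono (ℕ.n≤1+n (toℕ i))) (ℕ.≤-reflexive (sym eq)) , ℕ.≤-reflexive eq
    where
    to : SharedOf (ℕ.parity (idx i)) q × q ∈Seg i → label q ≡ a (idx i)
    to ((k , sh , par) , seg) with shared-index i sh seg
    ... | inj₂ k≡ = trans (proj₂ sh) (cong a k≡)
    ... | inj₁ k≡ = contradiction
      (trans (trans (cong ℕ.parity (sym k≡)) par) (parity-suc (toℕ i))) (ℙ.p≢p⁻¹ (ℕ.parity (toℕ i)))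
    i<t : label q ≡ a (idx i) → idx i < t
    i<t eq with ℕ.m≤n⇒m<n∨m≡n (Fin.toℕ<n i)
    ... | inj₁ i<t = i<t
    ... | inj₂ i≡t = contradiction (trans eq (cong a i≡t)) (ℕ.<⇒≢ (label<a q))
    toℕ≡ : ∀ eq → toℕ (fromℕ< (i<t eq)) ≡ idx i
    toℕ≡ eq = Fin.toℕ-fromℕ< (i<t eq)

  ∈S̆⇔interior : ∀ i q → q ∈S̆ i ⇔ Interior i (label q)
  ∈S̆⇔interior i q = mk⇔ to from
    where
    to : q ∈S̆ i → Interior i (label q)
    to ((lo , hi) , ¬shared) = ℕ.≤∧≢⇒< lo ≢start , ℕ.≤∧≢⇒< hi ≢end
      where
      ≢start : a (toℕ i) ≢ label q
      ≢start eq with (k , sh , _) , _ ← Equivalence.from (shared-start i q) (sym eq) = ¬shared (k , sh)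
      ≢end : label q ≢ a (idx i)
      ≢end eq with (k , sh , _) , _ ← Equivalence.from (shared-end i q) eq = ¬shared (k , sh)
    from : Interior i (label q) → q ∈S̆ i
    from (lo , hi) = seg , λ (k , sh) → ¬shared sh (shared-index i sh seg)
      where
      seg = ℕ.<⇒≤ lo , ℕ.<⇒≤ hi
      ¬shared : ∀ {k} → SharedAt q k → ¬ (toℕ k ≡ toℕ i ⊎ toℕ k ≡ idx i)
      ¬shared (_ , eq) (inj₁ k≡) = ℕ.<⇒≢ lo (sym (trans eq (cong a k≡)))
      ¬shared (_ , eq) (inj₂ k≡) = ℕ.<⇒≢ hi (trans eq (cong a k≡))

  module _ {i : Fin t} {r s : Fin n} (r-in : Interior i (label r)) (s-in : Interior i (label s)) where
    rising-order : ℕ.parity (idx i) ≡ 1ℙ → r ≼ s ⇔ label r ≤ label s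
    rising-order odd = mk⇔ to λ r≤s → linked⇒≤ (inj₁ (r≤s , λ j<s r≤j →
        i , odd , ℕ.≤-trans (ℕ.<⇒≤ (proj₁ r-in)) r≤j , ℕ.<-trans j<s (proj₂ s-in)))
      where
      to : r ≼ s → label r ≤ label s
      to r≼s with ≤⇒linked r≼s
      ... | inj₁ (r≤s , _) = r≤s
      ... | inj₂ (s≤r , falls) = ℕ.≮⇒≥ λ s<r →
        disjoint (i , odd , ℕ.<⇒≤ (proj₁ s-in) , proj₂ s-in) (falls s<r ℕ.≤-refl)

    falling-order : ℕ.parity (idx i) ≡ 0ℙ → r ≼ s ⇔ label s ≤ label r
    falling-order even = mk⇔ to λ s≤r → linked⇒≤ (inj₂ (s≤r , λ j<r s≤j →
        i , even , ℕ.≤-trans (ℕ.<⇒≤ (proj₁ s-in)) s≤j , ℕ.<-trans j<r (proj₂ r-in)))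
      where
      to : r ≼ s → label s ≤ label r
      to r≼s with ≤⇒linked r≼s
      ... | inj₂ (s≤r , _) = s≤r
      ... | inj₁ (r≤s , rises) = ℕ.≮⇒≥ λ r<s →
        disjoint (rises r<s ℕ.≤-refl) (i , even , ℕ.<⇒≤ (proj₁ r-in) , proj₂ r-in)

  module _ {i : Fin t} {j : ℕ} {s : Fin n} (nth : NthSmallest (_∈S̆? i) j s) where
    private
      s-in : Interior i (label s)
      s-in = Equivalence.to (∈S̆⇔interior i s) (proj₁ nth)

      interior : ∀ {r} → r ∈S̆ i → Interior i (label r)
      interior = Equivalence.to (∈S̆⇔interior i _)

    -- The chain up to `s` occupies the labels from `a (toℕ i) + 1` to `label s`; as values of `toℕ`
    -- these form the half-open interval from `a (toℕ i)` to `label s`.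
    rising-position : ℕ.parity (idx i) ≡ 1ℙ → label s ≡ a (toℕ i) + j
    rising-position odd = trans (sym (ℕ.m+[n∸m]≡n (ℕ.<⇒≤ (proj₁ s-in))))
      (cong (a (toℕ i) +_) (trans (sym count) (proj₂ nth)))
      where
      count : length (filter (λ r → (r ∈S̆? i) ×-dec (r ≼? s)) (allFin n)) ≡ label s ∸ a (toℕ i)
      count = length-filter-tabulate (λ r → (r ∈S̆? i) ×-dec (r ≼? s)) n id (a (toℕ i)) (label s) (Fin.toℕ<n s)
        λ r → mk⇔
          (λ (r∈ , r≼s) → ℕ.≤-pred (proj₁ (interior r∈))
                        , Equivalence.to (rising-order (interior r∈) s-in odd) r≼s)
          (λ (lo , r≤s) → let r-in = s≤s lo , ℕ.≤-<-trans r≤s (proj₂ s-in) in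
            Equivalence.from (∈S̆⇔interior i r) r-in , Equivalence.from (rising-order r-in s-in odd) r≤s)

    -- The order runs against the labels, so the position is counted from the right end. The labels
    -- from `label s` to `a (idx i) - 1` have `toℕ` values from `toℕ s` up to, but excluding,
    -- `a (idx i) ∸ 1`.
    falling-position : ℕ.parity (idx i) ≡ 0ℙ → label s + j ≡ a (idx i)
    falling-position even = trans (cong (label s +_) (trans (sym (proj₂ nth)) count))
      (complete (a (idx i)) (proj₂ s-in))
      where
      complete : ∀ {k} m → suc k < m → suc k + (m ∸ 1 ∸ k) ≡ m
      complete (suc m) (s≤s k<m) = cong suc (ℕ.m+[n∸m]≡n (ℕ.<⇒≤ k<m))

      count : length (filter (λ r → (r ∈S̆? i) ×-dec (r ≼? s)) (allFin n)) ≡ a (idx i) ∸ 1 ∸ toℕ s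
      count = length-filter-tabulate (λ r → (r ∈S̆? i) ×-dec (r ≼? s)) n id (toℕ s) (a (idx i) ∸ 1)
        (ℕ.∸-monoˡ-≤ 1 (a-idx≤a-t i))
        λ r → mk⇔
          (λ (r∈ , r≼s) → ℕ.≤-pred (Equivalence.to (falling-order (interior r∈) s-in even) r≼s)
                        , 1+n<m⇒n<m∸1 (a (idx i)) (proj₂ (interior r∈)))
          (λ (s≤r , hi) → let r-in = ℕ.<-≤-trans (proj₁ s-in) (s≤s s≤r) , n<m∸1⇒1+n<m (a (idx i)) hi in
            Equivalence.from (∈S̆⇔interior i r) r-in , Equivalence.from (falling-order r-in s-in even) (s≤s s≤r))

  -- Treats shared and virtual ends uniformly: `missing` is the constant by which the extended
  -- indicator exceeds the statistic. It is 0 at a shared element and `boundary k` where the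
  -- statistic is identically zero.
  record End (k : ℕ) (χ : Ideal → ℝ) : Set where
    field
      indicator : Ideal → ℕ
      missing   : ℕ
      seq-≡     : ∀ I x → seq (χ I) x ≡ ↑ (indicator I)
      completed : ∀ I → extended I k ≡ indicator I + missing

    total-≡ : ∀ O → total O k ≡ sum (map indicator (List⁺.toList O)) + missing * List⁺.length O
    total-≡ O = begin
      sum (map (λ I → extended I k) xs)
        ≡⟨ cong sum (List.map-cong completed xs) ⟩
      sum (map (λ I → indicator I + missing) xs)
        ≡⟨ sum-map-+ indicator (λ _ → missing) xs ⟩
      sum (map indicator xs) + sum (map (λ _ → missing) xs)
        ≡⟨ cong (sum (map indicator xs) +_) (sum-map-const missing xs) ⟩
      sum (map indicator xs) + missing * length xs ∎
      where
      open ≡-Reasoning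
      xs = List⁺.toList O

  segment-end : ∀ {P : Fin n → Set} k → (∀ q → P q ⇔ label q ≡ k) → (P? : Dec (∃ P)) → End k (χ̂-if-any P?)
  segment-end k P⇔ (yes (q , Pq)) = record
    { indicator = λ I → bit I q
    ; missing   = 0
    ; seq-≡     = seq-χ̂ q
    ; completed = λ I → trans (extended-label I q (Equivalence.to (P⇔ q) Pq)) (sym (ℕ.+-identityʳ (bit I q)))
    }
  segment-end k P⇔ (no ∄) = record
    { indicator = λ _ → 0
    ; missing   = boundary k
    ; seq-≡     = λ _ _ → refl
    ; completed = λ I → extended-boundary I λ q eq → ∄ (q , Equivalence.from (P⇔ q) eq)
    }

  homomesic-from-ends : ∀ i j s {p v} → j ≤ lookup α i → End p (χ̂-peak i) → End v (χ̂-valley i) →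
    (∀ O → IsOrbit Pro O →
      lookup α i * total O (label s) ≡ j * total O p + (lookup α i ∸ j) * total O v) →
    RationallyHomomesic Pro (segmentStat i j s)
  homomesic-from-ends i j s {p} {v} j≤α peak valley balanced =
      (λ I → ↑ A ℚ.* ↑ (bit I s) ℚ.- ↑ j ℚ.* ↑ (P.indicator I) ℚ.- ↑ m ℚ.* ↑ (V.indicator I))
    -- The constant average: the weighted contribution of virtual ends, which vanishes when the
    -- segment has both a peak and a valley.
    , (↑ j ℚ.* ↑ P.missing ℚ.+ ↑ m ℚ.* ↑ V.missing)
    , (λ I x → cong₂ ℚ._-_
        (cong₂ (λ y z → ↑ A ℚ.* y ℚ.- ↑ j ℚ.* z) (seq-χ̂ s I x) (P.seq-≡ I x))
        (cong₂ ℚ._*_ A-j (V.seq-≡ I x)))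
    , λ O orbit → trans
        (sumℚ-map-linear (↑ A) (↑ j) (↑ m) (λ I → bit I s) P.indicator V.indicator (List⁺.toList O))
        (balance (↑ A) (↑ j) (↑ m) _ _ _ _ (↑ P.missing) (↑ V.missing) (weighted O orbit))
    where
    module P = End peak
    module V = End valley
    A = lookup α i
    m = A ∸ j

    A-j : ↑ A ℚ.- ↑ j ≡ ↑ m
    A-j = begin
      ↑ A ℚ.- ↑ j              ≡⟨ cong (λ k → ↑ k ℚ.- ↑ j) (sym (ℕ.m∸n+n≡m j≤α)) ⟩
      ↑ (m + j) ℚ.- ↑ j        ≡⟨ cong (ℚ._- ↑ j) (↑-+ m j) ⟩
      ↑ m ℚ.+ ↑ j ℚ.- ↑ j      ≡⟨ ℚ.+-assoc (↑ m) (↑ j) (ℚ.- ↑ j) ⟩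
      ↑ m ℚ.+ (↑ j ℚ.- ↑ j)    ≡⟨ cong (↑ m ℚ.+_) (ℚ.+-inverseʳ (↑ j)) ⟩
      ↑ m ℚ.+ ℚ.0ℚ             ≡⟨ ℚ.+-identityʳ (↑ m) ⟩
      ↑ m                      ∎
      where open ≡-Reasoning

    ↑-total : ∀ {k χ} (e : End k χ) O → let open End e in
      ↑ (total O k) ≡ ↑ (sum (map indicator (List⁺.toList O))) ℚ.+ ↑ missing ℚ.* ↑ (List⁺.length O)
    ↑-total e O = trans (cong ↑ (total-≡ O))
      (trans (↑-+ Σ (missing * List⁺.length O)) (cong (↑ Σ ℚ.+_) (↑-* missing (List⁺.length O))))
      where
      open End e
      Σ = sum (map indicator (List⁺.toList O))

    weighted : ∀ O → IsOrbit Pro O →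
      ↑ A ℚ.* ↑ (sum (map (λ I → bit I s) (List⁺.toList O))) ≡
      ↑ j ℚ.* (↑ (sum (map P.indicator (List⁺.toList O))) ℚ.+ ↑ P.missing ℚ.* ↑ (List⁺.length O)) ℚ.+
      ↑ m ℚ.* (↑ (sum (map V.indicator (List⁺.toList O))) ℚ.+ ↑ V.missing ℚ.* ↑ (List⁺.length O))
    weighted O orbit = begin
      ↑ A ℚ.* ↑ (sum (map (λ I → bit I s) (List⁺.toList O)))
        ≡⟨ cong (λ ys → ↑ A ℚ.* ↑ (sum ys)) (List.map-cong (λ I → extended-label I s refl) (List⁺.toList O)) ⟨
      ↑ A ℚ.* ↑ (total O (label s))
        ≡⟨ ↑-* A (total O (label s)) ⟨
      ↑ (A * total O (label s))
        ≡⟨ cong ↑ (balanced O orbit) ⟩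
      ↑ (j * total O p + m * total O v)
        ≡⟨ ↑-+ (j * total O p) (m * total O v) ⟩
      ↑ (j * total O p) ℚ.+ ↑ (m * total O v)
        ≡⟨ cong₂ ℚ._+_ (↑-* j (total O p)) (↑-* m (total O v)) ⟩
      ↑ j ℚ.* ↑ (total O p) ℚ.+ ↑ m ℚ.* ↑ (total O v)
        ≡⟨ cong₂ (λ y z → ↑ j ℚ.* y ℚ.+ ↑ m ℚ.* z) (↑-total peak O) (↑-total valley O) ⟩
      _ ∎
      where open ≡-Reasoning

  segmentStat-homomesic : ∀ i j s → j ≤ lookup α i → NthSmallest (_∈S̆? i) j s →
                          RationallyHomomesic Pro (segmentStat i j s)
  segmentStat-homomesic i j s j≤α nth = helper (ℕ.parity (idx i)) refl
    where
    m = lookup α i ∸ j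

    anyPeak? = Fin.any? λ q → peak? q ×-dec (q ∈Seg? i)
    anyValley? = Fin.any? λ q → valley? q ×-dec (q ∈Seg? i)

    start-parity : ℕ.parity (toℕ i) ≡ ℕ.parity (idx i) ⁻¹
    start-parity = sym (ℙ.suc-homo-⁻¹ (toℕ i))

    start : ∀ {p} → ℕ.parity (idx i) ⁻¹ ≡ p → ∀ q → (SharedOf p q × q ∈Seg i) ⇔ (label q ≡ a (toℕ i))
    start eq q = subst (λ p → (SharedOf p q × q ∈Seg i) ⇔ (label q ≡ a (toℕ i)))
      (trans start-parity eq) (shared-start i q)

    finish : ∀ {p} → ℕ.parity (idx i) ≡ p → ∀ q → (SharedOf p q × q ∈Seg i) ⇔ (label q ≡ a (idx i))
    finish eq q = subst (λ p → (SharedOf p q × q ∈Seg i) ⇔ (label q ≡ a (idx i))) eq (shared-end i q)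

    helper : ∀ p → ℕ.parity (idx i) ≡ p → RationallyHomomesic Pro (segmentStat i j s)
    helper 1ℙ odd = homomesic-from-ends i j s j≤α
      (segment-end (a (idx i)) (finish odd) anyPeak?)
      (segment-end (a (toℕ i)) (start (cong _⁻¹ odd)) anyValley?)
      λ O orbit → subst
        (λ k → lookup α i * total O k ≡ j * total O (a (idx i)) + m * total O (a (toℕ i)))
        (sym (rising-position nth odd))
        (total-interpolate O orbit i j m (ℕ.m+[n∸m]≡n j≤α))
    -- In a falling segment the peak is on the left, so the distance of `s` from the left end is
    -- `m`, not `j`; the two interpolation weights are exchanged accordingly.
    helper 0ℙ even = homomesic-from-ends i j s j≤α
      (segment-end (a (toℕ i)) (start (cong _⁻¹ even)) anyPeak?)
      (segment-end (a (idx i)) (finish even) anyValley?)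
      λ O orbit → subst
        (λ k → lookup α i * total O k ≡ j * total O (a (toℕ i)) + m * total O (a (idx i)))
        (sym position)
        (trans (total-interpolate O orbit i m j (ℕ.m∸n+n≡m j≤α))
          (ℕ.+-comm (m * total O (a (idx i))) (j * total O (a (toℕ i)))))
      where
      position : label s ≡ a (toℕ i) + m
      position = ℕ.+-cancelʳ-≡ j (label s) (a (toℕ i) + m) (trans (falling-position nth even)
        (trans (a-suc i) (trans (cong (a (toℕ i) +_) (sym (ℕ.m∸n+n≡m j≤α)))
          (sym (ℕ.+-assoc (a (toℕ i)) m j)))))

  generator-homomesic : ∀ {g} → Generator g → RationallyHomomesic Pro g
  generator-homomesic (generator i j s _ j≤β nth) =
    segmentStat-homomesic i j s (ℕ.≤-trans j≤β (ℕ.m∸n≤m (lookup α i) 1)) nth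

theorem7p5 : ∀ {m : ℕ} (α : Vec ℕ (2 + m)) →
    All (1 ≤_) α → 2 ≤ head α → 2 ≤ last α →
    ∀ f → Span (Fence.Generator α) f → Homomesic (Fence.Pro α) f
theorem7p5 α α≥1 _ _ = span-homomesic (Generators.generator-homomesic α α≥1)
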